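{- Let $G=(V,E)$ be a finite undirected graph, let $d : V \to \mathbb{N}$, let $O$ be a set of states, and let $\mathbb{P}[\Phi]$ be a probability distribution over realizations $\Phi : E \to O$ with independent outcomes, i.e. $\mathbb{P}[\Phi] = \prod_{e \in E} \mathbb{P}[\Phi(e)]$. Let $\hat{f} : 2^{E \times O} \to \mathbb{R}_{\geq 0}$ be a monotone submodular set function, and define $f : 2^E \times O^E \to \mathbb{R}_{\geq 0}$ by $f(A,\Phi) := \hat{f}(\{(e,\Phi(e)) : e \in A\})$. Let $$\mathcal{I} := \{A \subseteq E : \deg_A(v) \leq d(v) \text{ for all } v \in V\}, \qquad \deg_A(v) := |\{w : \{v,w\} \in A\}|.$$ Let $\alpha \in [0,1]$ and let $\pi$ be any $\alpha$-approximate greedy policy with respect to $f$ for constraint $\mathcal{I}$. Then for every policy $\pi^*$ with $E(\pi^*,\Phi) \in \mathcal{I}$ for all $\Phi$ (in particular an optimal one), $$f_{\text{avg}}(\pi) \geq \frac{\alpha}{2+\alpha}\, f_{\text{avg}}(\pi^*).$$ In particular, the greedy policy ($\alpha = 1$) achieves a $1/3$-approximation to the optimal policy.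
   Context: This models adaptive match-making: $V$ is a set of people, items are edges (possible dates), $\Phi(e)\in O$ is the feedback from date $e$, and $d(v)$ is an upper bound on the number of dates of $v$. **Monotone submodular set function.** For a ground set $X$, $g : 2^X \to \mathbb{R}$ is monotone iff $g(A \cup \{x\}) - g(A) \geq 0$ for all $A \subseteq X$, $x \in X$, and submodular iff $g(A\cup\{x\}) - g(A) \geq g(B \cup \{x\}) - g(B)$ for all $A \subset B \subseteq X$ and $x \in X \setminus B$. **Realizations.** A realization is a function $\Phi : E \to O$ giving the state of each item. The distribution $\mathbb{P}[\Phi]$ is discrete (given by a probability mass function on $O^E$), and all expectations below are assumed to exist and be finite. A partial realization $\Psi$ is a function from a subset $\mathrm{dom}(\Psi) \subseteq E$ to $O$, identified with its graph $\{(e,o) : \Psi(e)=o\} \subseteq E \times O$. Write $\Phi \sim \Psi$ ($\Psi$ is consistent with $\Phi$) if $\Phi$ and $\Psi$ agree on $\mathrm{dom}(\Psi)$, and $\mathbb{P}[\Psi] := \mathbb{P}[\Phi \sim \Psi]$. $\Psi$ is a subrealization of $\Psi'$ iff $\Psi \subseteq \Psi'$. **Policies.** A (deterministic) policy $\pi$ is a function from a set $\mathrm{dom}(\pi)$ of partial realizations to $E$, where $\mathrm{dom}(\pi)$ is closed under subrealizations. Under realization $\Phi$ it runs as follows: start with $\Psi = \emptyset$; while $\Psi \in \mathrm{dom}(\pi)$, select item $e = \pi(\Psi)$, observe $\Phi(e)$, and replace $\Psi$ by $\Psi \cup \{(e,\Phi(e))\}$; terminate when $\Psi \notin \mathrm{dom}(\pi)$.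 $E(\pi,\Phi)$ denotes the set of items selected by $\pi$ under $\Phi$. The expected utility (reward) is $f_{\text{avg}}(\pi) := \mathbb{E}[f(E(\pi,\Phi),\Phi)]$, the expectation being with respect to $\mathbb{P}[\Phi]$. An optimal policy is one maximizing $f_{\text{avg}}$ among policies with $E(\pi,\Phi) \in \mathcal{I}$ for all $\Phi$. **Conditional expected marginal benefit.** For a partial realization $\Psi$ with $\mathbb{P}[\Psi]>0$ and $e \in E$, $\Delta(e \mid \Psi) := \mathbb{E}\left[f(\mathrm{dom}(\Psi) \cup \{e\},\Phi) - f(\mathrm{dom}(\Psi),\Phi) \mid \Phi \sim \Psi\right]$. **$\alpha$-approximate greedy policy for constraint $\mathcal{I}$.** A policy $\pi$ such that, upon observing a partial realization $\Psi$ (with $\mathbb{P}[\Psi]>0$): if there is an item $e \in E \setminus \mathrm{dom}(\Psi)$ with $\mathrm{dom}(\Psi) \cup \{e\} \in \mathcal{I}$, then $\pi$ selects such an item $e$ satisfying $\Delta(e \mid \Psi) \geq \alpha \cdot \max_{e' : \mathrm{dom}(\Psi) \cup \{e'\} \in \mathcal{I}} \Delta(e' \mid \Psi)$; if no such item exists, $\pi$ terminates. The greedy policy is the case $\alpha=1$. Graphs are simple: edges are two-element subsets $\{u,v\}$ of $V$. -}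

module Defs where

open import Algebra.Bundles using (CommutativeRing)
import Algebra.Construct.NaturalChoice.Max as Max
import Algebra.Properties.CommutativeMonoid.Sum as BigOperator
open import Data.Bool.Properties using () renaming (_≟_ to _≟ᵇ_)
open import Data.Fin.Base using (Fin)
open import Data.Fin.Properties using (all?; any?)
open import Data.Fin.Subset as Subset using (Subset; ⁅_⁆; ∣_∣)
open import Data.Fin.Subset.Properties using () renaming (_∈?_ to _∈ˢ?_)
open import Data.List.Base using (List; foldr; map; filter; allFin)
import Data.List.Extrema as Extrema
open import Data.List.Relation.Unary.All using (All)
open import Data.List.Relation.Unary.Unique.Propositional using (Unique)
open import Data.Maybe using (Maybe; just; nothing; is-just; Is-just; maybe′)
open import Data.Nat.Base as ℕ using (ℕ; zero; suc)
import Data.Nat.Properties as ℕ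
open import Data.Product.Base using (Σ; ∃; ∃-syntax; _×_; _,_)
open import Data.Vec.Base as Vec using (Vec; lookup; replicate; tabulate; _[_]≔_)
open import Data.Vec.Properties using (≡-dec)
open import Level using (0ℓ)
open import Relation.Binary.Bundles using (TotalOrder)
open import Relation.Binary.Core using (Rel)
open import Relation.Binary.PropositionalEquality.Core using (_≡_)
open import Relation.Binary.Structures using (IsTotalOrder)
open import Relation.Nullary.Decidable using (Dec; does; _×-dec_)
open import Relation.Nullary.Negation using (¬_)
open import Relation.Unary using (Pred; U; _∈_; _∉_; _⊆_; _≐_; _∪_; ｛_｝; Satisfiable)

-- The real numbers, axiomatised as a Dedekind-complete ordered field.
-- `_⁻¹` and `sup` are total; their values are unspecified at 0# and on
-- predicates that are empty or unbounded, respectively.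
record RealNumbers : Set₁ where
  infix  4 _≤_ _<_ _≥_
  infix  9 _⁻¹
  infixl 7 _/_
  field
    commutativeRing : CommutativeRing 0ℓ 0ℓ
  open CommutativeRing commutativeRing public
  field
    _≤_          : Rel Carrier 0ℓ
    isTotalOrder : IsTotalOrder _≈_ _≤_
    +-monoˡ-≤    : ∀ z {x y} → x ≤ y → x + z ≤ y + z
    *-nonNeg     : ∀ {x y} → 0# ≤ x → 0# ≤ y → 0# ≤ x * y
    0≉1          : ¬ 0# ≈ 1#
    _⁻¹          : Carrier → Carrier
    ⁻¹-inverse   : ∀ {x} → ¬ x ≈ 0# → x * x ⁻¹ ≈ 1#

  UpperBound : Pred Carrier 0ℓ → Carrier → Set
  UpperBound S b = ∀ {x} → x ∈ S → x ≤ b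

  Bounded : Pred Carrier 0ℓ → Set
  Bounded S = ∃ (UpperBound S)

  IsLub : Pred Carrier 0ℓ → Carrier → Set
  IsLub S s = UpperBound S s × (∀ {b} → UpperBound S b → s ≤ b)

  field
    sup     : Pred Carrier 0ℓ → Carrier
    sup-lub : ∀ {S} → Satisfiable S → Bounded S → IsLub S (sup S)

  totalOrder : TotalOrder 0ℓ 0ℓ 0ℓ
  totalOrder = record { isTotalOrder = isTotalOrder }

  open Max totalOrder public using (_⊔_)
  open Extrema totalOrder public using (max)

  _≥_ _<_ : Rel Carrier 0ℓ
  x ≥ y = y ≤ x
  x < y = x ≤ y × ¬ x ≈ y

  _/_ : Carrier → Carrier → Carrier
  x / y = x * y ⁻¹

  2# 3# : Carrier
  2# = 1# + 1#
  3# = 2# + 1#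

  ∏ : ∀ {n} → (Fin n → Carrier) → Carrier
  ∏ = BigOperator.sum *-commutativeMonoid

-- A finite simple graph on the vertices Fin order.  Its edges, which are
-- two-element sets of vertices, are enumerated without repetition by Fin size.
record Graph : Set where
  field
    order          : ℕ
    size           : ℕ
    ends           : Fin size → Subset order
    ends-card      : ∀ e → ∣ ends e ∣ ≡ 2
    ends-injective : ∀ {e e′} → ends e ≡ ends e′ → e ≡ e′

  Vertex Edge : Set
  Vertex = Fin order
  Edge   = Fin size

  Joins : Subset size → Vertex → Vertex → Set
  Joins A v w = ∃[ e ] (e Subset.∈ A × ends e ≡ ⁅ v ⁆ Subset.∪ ⁅ w ⁆)

  joins? : ∀ A v w → Dec (Joins A v w)
  joins? A v w = any? λ e → (e ∈ˢ? A) ×-dec ≡-dec _≟ᵇ_ (ends e) (⁅ v ⁆ Subset.∪ ⁅ w ⁆)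

  deg : Subset size → Vertex → ℕ
  deg A v = ∣ tabulate (λ w → does (joins? A v w)) ∣

module SetFunctions (ℝ : RealNumbers) where
  open RealNumbers ℝ

  -- Functions 2^X → ℝ≥0; `cong` says that the value depends only on the
  -- extension of a predicate.
  record SetFunction (X : Set) : Set₁ where
    field
      apply  : Pred X 0ℓ → Carrier
      cong   : ∀ {A B} → A ≐ B → apply A ≈ apply B
      nonNeg : ∀ A → 0# ≤ apply A

  open SetFunction public using (apply)

  Monotone : ∀ {X} → SetFunction X → Set₁
  Monotone g = ∀ A x → apply g (A ∪ ｛ x ｝) - apply g A ≥ 0#

  Submodular : ∀ {X} → SetFunction X → Set₁
  Submodular g = ∀ A B x → A ⊆ B → x ∉ B →
    apply g (A ∪ ｛ x ｝) - apply g A ≥ apply g (B ∪ ｛ x ｝) - apply g B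

module DiscreteProbability (ℝ : RealNumbers) (Ω : Set) where
  open RealNumbers ℝ

  PartialSum : Pred Ω 0ℓ → (Ω → Carrier) → Pred Carrier 0ℓ
  PartialSum Q g s = Σ (List Ω) λ L →
    Unique L × All (_∈ Q) L × s ≈ foldr _+_ 0# (map g L)

  -- The possibly infinite sum of g over Q, for g ≥ 0.
  ∑⁺ : Pred Ω 0ℓ → (Ω → Carrier) → Carrier
  ∑⁺ Q g = sup (PartialSum Q g)

  record Distribution : Set where
    field
      mass   : Ω → Carrier
      nonNeg : ∀ ω → 0# ≤ mass ω
      total  : IsLub (PartialSum U mass) 1#

  open Distribution public using (mass)

  posPart negPart : (Ω → Carrier) → Ω → Carrier
  posPart X ω = X ω ⊔ 0#
  negPart X ω = (- X ω) ⊔ 0#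

  module _ (𝒫 : Distribution) where

    Prob : Pred Ω 0ℓ → Carrier
    Prob Q = ∑⁺ Q (mass 𝒫)

    weighted : (Ω → Carrier) → Ω → Carrier
    weighted X ω = mass 𝒫 ω * X ω

    HasExpectation : (Ω → Carrier) → Set
    HasExpectation X = Bounded (PartialSum U (weighted (posPart X)))
                     × Bounded (PartialSum U (weighted (negPart X)))

    -- 𝔼[X · 1_Q]
    𝔼-on : Pred Ω 0ℓ → (Ω → Carrier) → Carrier
    𝔼-on Q X = ∑⁺ Q (weighted (posPart X)) - ∑⁺ Q (weighted (negPart X))

    𝔼 : (Ω → Carrier) → Carrier
    𝔼 = 𝔼-on U

    𝔼[_∣_] : (Ω → Carrier) → Pred Ω 0ℓ → Carrier
    𝔼[ X ∣ Q ] = 𝔼-on Q X / Prob Q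

module Matchmaking (ℝ : RealNumbers) (G : Graph) (d : Graph.Vertex G → ℕ) (O : Set) where
  open RealNumbers ℝ
  open Graph G
  open SetFunctions ℝ public

  -- A function E → O is stored as the vector of its values, so that _≡_ is
  -- equality of functions; similarly for partial functions below.
  Realization : Set
  Realization = Vec O size

  PartialRealization : Set
  PartialRealization = Vec (Maybe O) size

  open DiscreteProbability ℝ Realization public

  ∅ : PartialRealization
  ∅ = replicate size nothing

  dom : PartialRealization → Subset size
  dom = Vec.map is-just

  infix 4 _∼_ _⊑_

  _∼_ : Realization → PartialRealization → Set
  Φ ∼ Ψ = ∀ {e o} → lookup Ψ e ≡ just o → lookup Φ e ≡ o

  _⊑_ : PartialRealization → PartialRealization → Set
  Ψ ⊑ Ψ′ = ∀ {e o} → lookup Ψ e ≡ just o → lookup Ψ′ e ≡ just o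

  Independent : Distribution → Set
  Independent 𝒫 = ∀ Φ →
    mass 𝒫 Φ ≈ ∏ (λ e → Prob 𝒫 (λ Φ′ → lookup Φ′ e ≡ lookup Φ e))

  -- The domain of the policy consists of the Ψ with `choose Ψ` not `nothing`.
  record Policy : Set where
    field
      choose : PartialRealization → Maybe Edge
      closed : ∀ {Ψ Ψ′} → Ψ ⊑ Ψ′ → Is-just (choose Ψ′) → Is-just (choose Ψ)

  open Policy public using (choose)

  step : Policy → Realization → PartialRealization → PartialRealization
  step π Φ Ψ = maybe′ (λ e → Ψ [ e ]≔ just (lookup Φ e)) Ψ (choose π Ψ)

  run : Policy → Realization → ℕ → PartialRealization
  run π Φ zero    = ∅
  run π Φ (suc k) = step π Φ (run π Φ k)

  -- A step that selects no new item leaves the partial realization unchanged,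
  -- and then so do all later ones: after `size` steps every item that is ever
  -- selected has been selected, even for a policy that repeats items forever.
  selected : Policy → Realization → Subset size
  selected π Φ = dom (run π Φ size)

  Observes : Policy → Pred PartialRealization 0ℓ
  Observes π Ψ = ∃[ Φ ] ∃[ k ] Ψ ≡ run π Φ k

  𝓘 : Pred (Subset size) 0ℓ
  𝓘 A = ∀ v → deg A v ℕ.≤ d v

  𝓘? : ∀ A → Dec (A ∈ 𝓘)
  𝓘? A = all? λ v → deg A v ℕ.≤? d v

  FeasiblePolicy : Policy → Set
  FeasiblePolicy π = ∀ Φ → selected π Φ ∈ 𝓘

  Feasible : PartialRealization → Pred Edge 0ℓ
  Feasible Ψ e = dom Ψ Subset.∪ ⁅ e ⁆ ∈ 𝓘

  feasibleEdges : PartialRealization → List Edge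
  feasibleEdges Ψ = filter (λ e → 𝓘? (dom Ψ Subset.∪ ⁅ e ⁆)) (allFin size)

  Candidate : PartialRealization → Pred Edge 0ℓ
  Candidate Ψ e = e Subset.∉ dom Ψ × e ∈ Feasible Ψ

  Utility : Set
  Utility = Subset size → Realization → Carrier

  utility : SetFunction (Edge × O) → Utility
  utility f̂ A Φ = apply f̂ λ (e , o) → e Subset.∈ A × lookup Φ e ≡ o

  module _ (𝒫 : Distribution) (f : Utility) where

    avg : Policy → Carrier
    avg π = 𝔼 𝒫 (λ Φ → f (selected π Φ) Φ)

    Δ : Edge → PartialRealization → Carrier
    Δ e Ψ = 𝔼[_∣_] 𝒫 (λ Φ → f (dom Ψ Subset.∪ ⁅ e ⁆) Φ - f (dom Ψ) Φ) (_∼ Ψ)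

    -- The first argument of `max` is only its value on the empty list; here e
    -- itself belongs to the list.
    ApproxBest : Carrier → PartialRealization → Pred Edge 0ℓ
    ApproxBest α Ψ e =
      Δ e Ψ ≥ α * max (Δ e Ψ) (map (λ e′ → Δ e′ Ψ) (feasibleEdges Ψ))

    ApproxGreedy : Carrier → Policy → Set
    ApproxGreedy α π = ∀ Ψ → Ψ ∈ Observes π → 0# < Prob 𝒫 (_∼ Ψ) →
        (∃ (Candidate Ψ) → ∃[ e ] (choose π Ψ ≡ just e × Candidate Ψ e × ApproxBest α Ψ e))
      × (¬ ∃ (Candidate Ψ) → choose π Ψ ≡ nothing)

    Greedy : Policy → Set
    Greedy = ApproxGreedy 1#

{-# OPTIONS --safe #-}

-- Run π under Φ, and then run π* afresh under the same Φ. By monotonicity the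
-- union of both selections is worth at least that of π*, so it suffices to
-- bound what π* adds to the selection of π. Whether an item is picked next does
-- not depend on its own outcome. By independence its marginal may therefore be
-- replaced by the expectation over a fresh outcome, which by submodularity only
-- grows when it is taken relative to an earlier observation of π. Every item
-- added by π* can be charged to a step of π at which it was still a candidate,
-- so that α times its expected marginal is at most that of the item selected by
-- π in that step. As an edge selected by π blocks at most one other edge at each
-- of its two ends, no step is charged more than twice, and
-- α (avg π* - avg π) ≤ 2 avg π.
module Submission where

open import Defs
open import Axiom.ExcludedMiddle using (ExcludedMiddle)
open import Data.Nat.Base using (ℕ)
open import Data.Product.Base using (_×_)
open import Level using (0ℓ)

import Algebra.Construct.NaturalChoice.Max as NaturalMax
import Algebra.Properties.AbelianGroup as AbelianGroupProperties
import Algebra.Properties.CommutativeMonoid.Sum as BigOperator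
import Algebra.Properties.CommutativeSemigroup as CommutativeSemigroupProperties
import Algebra.Properties.Ring as RingProperties
open import Data.Bool.Base using (true; false; if_then_else_)
open import Data.Bool.Properties using (∨-zeroʳ)
open import Data.Fin.Base using (Fin; zero; suc)
open import Data.Fin.Properties using (_≟_)
open import Data.Fin.Subset as Subset using (Subset; ⁅_⁆; ∣_∣)
import Data.Fin.Subset.Properties as Subset
open import Data.List.Base
  using (List; []; _∷_; _++_; filter; foldr; deduplicate; cartesianProduct; allFin)
  renaming (map to mapᴸ)
import Data.List.Extrema as Extrema
open import Data.List.Membership.Propositional using () renaming (_∈_ to _∈ᴸ_)
open import Data.List.Membership.Propositional.Properties
  using (∈-∃++; ∈-++⁺ˡ; ∈-++⁺ʳ; ∈-map⁺; ∈-map⁻; ∈-filter⁺; ∈-filter⁻; ∈-allFin;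
         ∈-cartesianProduct⁺; ∈-deduplicate⁺)
import Data.List.Properties as List
import Data.List.Relation.Binary.Permutation.Propositional.Properties as Perm
open import Data.List.Relation.Unary.All as All using (All; []; _∷_)
open import Data.List.Relation.Unary.All.Properties using (all-filter)
open import Data.List.Relation.Unary.AllPairs using ([]; _∷_)
open import Data.List.Relation.Unary.Any using (here; there)
open import Data.List.Relation.Unary.Unique.DecPropositional.Properties using (deduplicate-!)
open import Data.List.Relation.Unary.Unique.Propositional using (Unique)
open import Data.List.Relation.Unary.Unique.Propositional.Properties
  using (cartesianProduct⁺; filter⁺) renaming (map⁺ to Unique-map⁺)
open import Data.Maybe.Base using (Maybe; just; nothing; is-just)
open import Data.Nat.Base as ℕ using (zero; suc; s≤s)
import Data.Nat.Properties as ℕ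
open import Data.Product.Base using (∃-syntax; _,_; proj₁; proj₂)
open import Data.Sum.Base using (_⊎_; inj₁; inj₂; [_,_]′)
open import Data.Unit.Base using (tt)
open import Data.Vec.Base using ([]; _∷_; here; there; lookup; tabulate; _[_]≔_)
open import Data.Vec.Properties
  using (lookup∘tabulate; lookup∘update; lookup∘update′; lookup-map; lookup-replicate; map-[]≔;
         []=⇒lookup; lookup⇒[]=; []≔-idempotent; []≔-lookup)
open import Function.Base using (_∘_; _$_; id)
open import Relation.Binary.Bundles using (TotalOrder)
open import Relation.Binary.PropositionalEquality as ≡ using (_≡_; _≢_)
import Relation.Binary.Reasoning.PartialOrder as PartialOrderReasoning
open import Relation.Nullary.Decidable using (Dec; yes; no; does)
open import Relation.Nullary.Negation using (¬_; contradiction)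
open import Relation.Unary
  using (Pred; U; _∈_; _∉_; _⊆_; _≐_; _∪_; ｛_｝; Satisfiable)

-- Realised marginals of the two policies are not comparable, because greediness only controls `Δ`.
-- Both runs are therefore compensated: with each realised marginal replaced by its expectation over
-- a fresh outcome, the charging inequality holds separately for every realization of positive mass,
-- and only then are means taken. No conditioning on histories is used for this. The replacement
-- exchanges one coordinate between two independent copies of the realization and sums over pairs in
-- both orders. The same device, applied to the event of being consistent with an observation, turns
-- the conditional expectation in `Δ` into an unconditional mean, so that greediness and the
-- compensators speak of the same quantity. There may be infinitely many realizations, so every sum
-- is a supremum whose existence has to be secured: `f ⊤` dominates the utility of any random
-- selection, and `f ⁅ e ⁆` every marginal of a new item `e`.

-- Arithmetic in the ordered field of reals

module RealProperties (ℝ : RealNumbers) where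
  open RealNumbers ℝ
  open AbelianGroupProperties +-abelianGroup using (//-rightDividesˡ; //-rightDividesʳ)
  open RingProperties ring using (-‿distribʳ-*; -‿involutive)

  open TotalOrder totalOrder public using ()
    renaming (refl to ≤-refl; reflexive to ≤-reflexive; trans to ≤-trans;
              antisym to ≤-antisym; total to ≤-total; ≤-respʳ-≈ to ≤-respʳ; ≤-respˡ-≈ to ≤-respˡ)

  module ≤-Reasoning = PartialOrderReasoning (TotalOrder.poset totalOrder)

  open NaturalMax totalOrder public using (x≤y⇒x⊔y≈y) renaming (x≤y⇒y⊔x≈y to x≥y⇒x⊔y≈x)

  module + = CommutativeSemigroupProperties +-commutativeSemigroup
  module * = CommutativeSemigroupProperties *-commutativeSemigroup

  +-monoʳ-≤ : ∀ z {x y} → x ≤ y → z + x ≤ z + y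
  +-monoʳ-≤ z x≤y = ≤-respˡ (+-comm _ _) (≤-respʳ (+-comm _ _) (+-monoˡ-≤ z x≤y))

  +-mono-≤ : ∀ {x y u v} → x ≤ y → u ≤ v → x + u ≤ y + v
  +-mono-≤ x≤y u≤v = ≤-trans (+-monoˡ-≤ _ x≤y) (+-monoʳ-≤ _ u≤v)

  +-nonNeg : ∀ {x y} → 0# ≤ x → 0# ≤ y → 0# ≤ x + y
  +-nonNeg 0≤x 0≤y = ≤-respˡ (+-identityˡ 0#) (+-mono-≤ 0≤x 0≤y)

  x≤x+y : ∀ {x y} → 0# ≤ y → x ≤ x + y
  x≤x+y {x} 0≤y = ≤-respˡ (+-identityʳ x) (+-monoʳ-≤ x 0≤y)

  y≤x+y : ∀ {x y} → 0# ≤ x → y ≤ x + y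
  y≤x+y {_} {y} 0≤x = ≤-respˡ (+-identityˡ y) (+-monoˡ-≤ y 0≤x)

  x-y+y≈x : ∀ x y → (x - y) + y ≈ x
  x-y+y≈x x y = //-rightDividesˡ y x

  x+y-y≈x : ∀ x y → (x + y) - y ≈ x
  x+y-y≈x x y = //-rightDividesʳ y x

  y+[x-y]≈x : ∀ x y → y + (x - y) ≈ x
  y+[x-y]≈x x y = trans (+-comm _ _) (x-y+y≈x x y)

  x+y≤z⇒x≤z-y : ∀ {x y z} → x + y ≤ z → x ≤ z - y
  x+y≤z⇒x≤z-y {x} {y} h = ≤-respˡ (x+y-y≈x x y) (+-monoˡ-≤ (- y) h)

  x≤z-y⇒x+y≤z : ∀ {x y z} → x ≤ z - y → x + y ≤ z
  x≤z-y⇒x+y≤z {x} {y} {z} h = ≤-respʳ (x-y+y≈x z y) (+-monoˡ-≤ y h)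

  0≤y-x⇒x≤y : ∀ {x y} → 0# ≤ y - x → x ≤ y
  0≤y-x⇒x≤y {x} h = ≤-respˡ (+-identityˡ x) (x≤z-y⇒x+y≤z h)

  x≤y⇒0≤y-x : ∀ {x y} → x ≤ y → 0# ≤ y - x
  x≤y⇒0≤y-x {x} h = x+y≤z⇒x≤z-y (≤-respˡ (sym (+-identityˡ x)) h)

  x-y≤x : ∀ {x y} → 0# ≤ y → x - y ≤ x
  x-y≤x {x} {y} 0≤y = ≤-respʳ (x-y+y≈x x y) (x≤x+y 0≤y)

  0≤x⇒-x≤0 : ∀ {x} → 0# ≤ x → - x ≤ 0#
  0≤x⇒-x≤0 {x} 0≤x = ≤-respˡ (+-identityˡ (- x)) (x-y≤x 0≤x)

  x≤0⇒0≤-x : ∀ {x} → x ≤ 0# → 0# ≤ - x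
  x≤0⇒0≤-x {x} x≤0 = ≤-respʳ (+-identityˡ (- x)) (x≤y⇒0≤y-x x≤0)

  *-monoʳ-≤ : ∀ {c x y} → 0# ≤ c → x ≤ y → c * x ≤ c * y
  *-monoʳ-≤ {c} {x} {y} 0≤c x≤y = 0≤y-x⇒x≤y $ ≤-respʳ c[y-x]≈cy-cx
    (*-nonNeg 0≤c (x≤y⇒0≤y-x x≤y))
    where
    c[y-x]≈cy-cx : c * (y - x) ≈ c * y - c * x
    c[y-x]≈cy-cx = trans (distribˡ c y (- x)) (+-congˡ (sym (-‿distribʳ-* c x)))

  0≤1 : 0# ≤ 1#
  0≤1 with ≤-total 0# 1#
  ... | inj₁ 0≤1 = 0≤1
  ... | inj₂ 1≤0 = ≤-respʳ [-1]²≈1 (*-nonNeg (x≤0⇒0≤-x 1≤0) (x≤0⇒0≤-x 1≤0))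
    where
    [-1]²≈1 : - 1# * - 1# ≈ 1#
    [-1]²≈1 = trans (sym (-‿distribʳ-* (- 1#) 1#))
      (trans (-‿cong (*-identityʳ (- 1#))) (-‿involutive 1#))

  ⁻¹-nonNeg : ∀ {x} → 0# ≤ x → ¬ x ≈ 0# → 0# ≤ x ⁻¹
  ⁻¹-nonNeg {x} 0≤x x≉0 with ≤-total 0# (x ⁻¹)
  ... | inj₁ 0≤x⁻¹ = 0≤x⁻¹
  ... | inj₂ x⁻¹≤0 = contradiction (≤-antisym 0≤1 1≤0) 0≉1
    where
    1≤0 : 1# ≤ 0#
    1≤0 = ≤-respˡ (⁻¹-inverse x≉0) (≤-respʳ (zeroʳ x) (*-monoʳ-≤ 0≤x x⁻¹≤0))

  x⁻¹*[x*y]≈y : ∀ {x} → ¬ x ≈ 0# → ∀ y → x ⁻¹ * (x * y) ≈ y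
  x⁻¹*[x*y]≈y {x} x≉0 y = trans (sym (*-assoc _ _ _))
    (trans (*-congʳ (trans (*-comm _ _) (⁻¹-inverse x≉0))) (*-identityˡ y))

-- Unordered sums as least upper bounds of finite sums

module Summation (em : ExcludedMiddle 0ℓ) (ℝ : RealNumbers) where
  open RealNumbers ℝ
  open RealProperties ℝ

  private
    variable
      X Y : Set

  sumOver : (X → Carrier) → List X → Carrier
  sumOver g L = foldr _+_ 0# (mapᴸ g L)

  sumOver-cong : ∀ {g h : X → Carrier} → (∀ x → g x ≈ h x) → ∀ L → sumOver g L ≈ sumOver h L
  sumOver-cong g≈h []      = refl
  sumOver-cong g≈h (x ∷ L) = +-cong (g≈h x) (sumOver-cong g≈h L)

  sumOver-mono : ∀ {g h : X → Carrier} → (∀ x → g x ≤ h x) → ∀ L → sumOver g L ≤ sumOver h L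
  sumOver-mono g≤h []      = ≤-refl
  sumOver-mono g≤h (x ∷ L) = +-mono-≤ (g≤h x) (sumOver-mono g≤h L)

  sumOver-nonNeg : ∀ {g : X → Carrier} → (∀ x → 0# ≤ g x) → ∀ L → 0# ≤ sumOver g L
  sumOver-nonNeg 0≤g []      = ≤-refl
  sumOver-nonNeg 0≤g (x ∷ L) = +-nonNeg (0≤g x) (sumOver-nonNeg 0≤g L)

  sumOver-0 : ∀ (L : List X) → sumOver (λ _ → 0#) L ≈ 0#
  sumOver-0 []      = refl
  sumOver-0 (x ∷ L) = trans (+-identityˡ _) (sumOver-0 L)

  sumOver-+ : ∀ (g h : X → Carrier) L → sumOver (λ x → g x + h x) L ≈ sumOver g L + sumOver h L
  sumOver-+ g h []      = sym (+-identityˡ 0#)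
  sumOver-+ g h (x ∷ L) = trans (+-congˡ (sumOver-+ g h L))
    (+.interchange _ _ _ _)

  sumOver-* : ∀ c (g : X → Carrier) L → sumOver (λ x → c * g x) L ≈ c * sumOver g L
  sumOver-* c g []      = sym (zeroʳ c)
  sumOver-* c g (x ∷ L) = trans (+-congˡ (sumOver-* c g L)) (sym (distribˡ c _ _))

  sumOver-++ : ∀ (g : X → Carrier) L M → sumOver g (L ++ M) ≈ sumOver g L + sumOver g M
  sumOver-++ g []      M = sym (+-identityˡ _)
  sumOver-++ g (x ∷ L) M = trans (+-congˡ (sumOver-++ g L M)) (sym (+-assoc _ _ _))

  sumOver-map : ∀ (g : Y → Carrier) (k : X → Y) L → sumOver g (mapᴸ k L) ≈ sumOver (g ∘ k) L
  sumOver-map g k L = reflexive (≡.cong (foldr _+_ 0#) (≡.sym (List.map-∘ L)))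

  sumOver-cartesianProduct : ∀ (g : X × Y → Carrier) L M →
    sumOver g (cartesianProduct L M) ≈ sumOver (λ x → sumOver (λ y → g (x , y)) M) L
  sumOver-cartesianProduct g []      M = refl
  sumOver-cartesianProduct g (x ∷ L) M = trans (sumOver-++ g (mapᴸ (x ,_) M) _)
    (+-cong (sumOver-map g (x ,_) M) (sumOver-cartesianProduct g L M))

  sumOver-swap : ∀ (g : X → Y → Carrier) L M →
    sumOver (λ x → sumOver (g x) M) L ≈ sumOver (λ y → sumOver (λ x → g x y) L) M
  sumOver-swap g []      M = sym (sumOver-0 M)
  sumOver-swap g (x ∷ L) M = trans (+-congˡ (sumOver-swap g L M)) (sym (sumOver-+ _ _ M))

  sumOver-⊆ : ∀ {g : X → Carrier} → (∀ x → 0# ≤ g x) → ∀ {L M} → Unique L →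
              (∀ {x} → x ∈ᴸ L → x ∈ᴸ M) → sumOver g L ≤ sumOver g M
  sumOver-⊆ 0≤g {[]} {M} _ _ = sumOver-nonNeg 0≤g M
  sumOver-⊆ {g = g} 0≤g {x ∷ L} (x≢ ∷ L!) L⊆M with ∈-∃++ (L⊆M (here ≡.refl))
  ... | M₁ , M₂ , ≡.refl = begin
    g x + sumOver g L                 ≤⟨ +-monoʳ-≤ (g x) (sumOver-⊆ 0≤g L! L⊆M₁M₂) ⟩
    g x + sumOver g (M₁ ++ M₂)        ≈⟨ +-congˡ (sumOver-++ g M₁ M₂) ⟩
    g x + (sumOver g M₁ + sumOver g M₂)
      ≈⟨ +.x∙yz≈y∙xz _ _ _ ⟩
    sumOver g M₁ + (g x + sumOver g M₂) ≈⟨ sumOver-++ g M₁ (x ∷ M₂) ⟨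
    sumOver g (M₁ ++ x ∷ M₂)          ∎
    where
    open ≤-Reasoning
    L⊆M₁M₂ : ∀ {y} → y ∈ᴸ L → y ∈ᴸ M₁ ++ M₂
    L⊆M₁M₂ y∈L with Perm.∈-resp-↭ (Perm.shift x M₁ M₂) (L⊆M (there y∈L))
    ... | here y≡x = contradiction (≡.sym y≡x) (All.lookup x≢ y∈L)
    ... | there y∈ = y∈

  BoundedBy : (X → Carrier) → Carrier → Set
  BoundedBy g b = ∀ L → Unique L → sumOver g L ≤ b

  -- As a relation this asserts both existence and value of the sum, whereas `sup` has an
  -- unspecified value on an unbounded predicate.
  record HasSum {X : Set} (g : X → Carrier) (s : Carrier) : Set where
    constructor hasSum
    field
      upper : BoundedBy g s
      least : ∀ {b} → BoundedBy g b → s ≤ b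

  infix 4 _≲_

  -- Comparing bounds instead of terms allows different index types and presupposes no sum; mutual
  -- comparison transfers existence as well as value.
  _≲_ : (X → Carrier) → (Y → Carrier) → Set
  g ≲ h = ∀ {b} → BoundedBy h b → BoundedBy g b

  HasSum-≤ : ∀ {g : X → Carrier} {h : Y → Carrier} {s t} → g ≲ h → HasSum g s → HasSum h t → s ≤ t
  HasSum-≤ g≲h (hasSum _ least) (hasSum upper _) = least (g≲h upper)

  HasSum-resp : ∀ {g : X → Carrier} {h : Y → Carrier} {s} → g ≲ h → h ≲ g → HasSum g s → HasSum h s
  HasSum-resp g≲h h≲g (hasSum upper least) = hasSum (h≲g upper) (least ∘ g≲h)

  HasSum-unique : ∀ {g : X → Carrier} {s t} → HasSum g s → HasSum g t → s ≈ t
  HasSum-unique gs gt = ≤-antisym (HasSum-≤ id gs gt) (HasSum-≤ id gt gs)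

  HasSum-value : ∀ {g : X → Carrier} {s t} → s ≈ t → HasSum g s → HasSum g t
  HasSum-value s≈t (hasSum upper least) =
    hasSum (λ L L! → ≤-respʳ s≈t (upper L L!)) (≤-respˡ s≈t ∘ least)

  ≤⇒≲ : ∀ {g h : X → Carrier} → (∀ x → g x ≤ h x) → g ≲ h
  ≤⇒≲ g≤h h-bounded L L! = ≤-trans (sumOver-mono g≤h L) (h-bounded L L!)

  HasSum-cong : ∀ {g h : X → Carrier} {s} → (∀ x → g x ≈ h x) → HasSum g s → HasSum h s
  HasSum-cong g≈h = HasSum-resp (≤⇒≲ (≤-reflexive ∘ g≈h)) (≤⇒≲ (≤-reflexive ∘ sym ∘ g≈h))

  HasSum-0 : HasSum {X} (λ _ → 0#) 0#
  HasSum-0 = hasSum (λ L _ → ≤-reflexive (sumOver-0 L)) (λ bound → bound [] [])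

  -- The lists that nearly exhaust `g` and `h` may differ. Nonnegativity permits enlarging both to
  -- one common duplicate-free list.
  HasSum-+ : ∀ {g h : X → Carrier} {s t} → (∀ x → 0# ≤ g x) → (∀ x → 0# ≤ h x) →
             HasSum g s → HasSum h t → HasSum (λ x → g x + h x) (s + t)
  HasSum-+ {X} {g} {h} {s} {t} 0≤g 0≤h (hasSum g-upper g-least) (hasSum h-upper h-least) =
    hasSum upper least
    where
    upper : BoundedBy (λ x → g x + h x) (s + t)
    upper L L! = ≤-respˡ (sym (sumOver-+ g h L)) (+-mono-≤ (g-upper L L!) (h-upper L L!))

    least : ∀ {b} → BoundedBy (λ x → g x + h x) b → s + t ≤ b
    least {b} bound = x≤z-y⇒x+y≤z (g-least λ L L! →
      x+y≤z⇒x≤z-y (≤-respˡ (+-comm _ _) (x≤z-y⇒x+y≤z (h-least λ M M! →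
      x+y≤z⇒x≤z-y (≤-respˡ (+-comm _ _) (separate L L! M M!))))))
      where
      separate : ∀ L → Unique L → ∀ M → Unique M → sumOver g L + sumOver h M ≤ b
      separate L L! M M! = begin
        sumOver g L + sumOver h M     ≤⟨ +-mono-≤ (sumOver-⊆ 0≤g L! L⊆N) (sumOver-⊆ 0≤h M! M⊆N) ⟩
        sumOver g N + sumOver h N     ≈⟨ sumOver-+ g h N ⟨
        sumOver (λ x → g x + h x) N   ≤⟨ bound N (deduplicate-! (λ _ _ → em) _) ⟩
        b                             ∎
        where
        open ≤-Reasoning
        N : List X
        N = deduplicate (λ _ _ → em) (L ++ M)
        L⊆N : ∀ {x} → x ∈ᴸ L → x ∈ᴸ N
        L⊆N x∈L = ∈-deduplicate⁺ (λ _ _ → em) (∈-++⁺ˡ x∈L)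
        M⊆N : ∀ {x} → x ∈ᴸ M → x ∈ᴸ N
        M⊆N x∈M = ∈-deduplicate⁺ (λ _ _ → em) (∈-++⁺ʳ L x∈M)

  HasSum-* : ∀ {c} {g : X → Carrier} {s} → 0# ≤ c → HasSum g s → HasSum (λ x → c * g x) (c * s)
  HasSum-* {c = c} {g} {s} 0≤c (hasSum g-upper g-least) = hasSum
    (λ L L! → ≤-respˡ (sym (sumOver-* c g L)) (*-monoʳ-≤ 0≤c (g-upper L L!)))
    (least em)
    where
    open ≤-Reasoning
    least : Dec (c ≈ 0#) → ∀ {b} → BoundedBy (λ x → c * g x) b → c * s ≤ b
    -- Here `c` cannot be divided out; the empty list shows that `b` is nonnegative.
    least (yes c≈0) bound = ≤-respˡ (sym (trans (*-congʳ c≈0) (zeroˡ s))) (bound [] [])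
    least (no c≉0) {b} bound = begin
      c * s            ≤⟨ *-monoʳ-≤ 0≤c (g-least g-bounded) ⟩
      c * (c ⁻¹ * b)   ≈⟨ *.x∙yz≈y∙xz _ _ _ ⟩
      c ⁻¹ * (c * b)   ≈⟨ x⁻¹*[x*y]≈y c≉0 b ⟩
      b                ∎
      where
      g-bounded : BoundedBy g (c ⁻¹ * b)
      g-bounded L L! = begin
        sumOver g L                        ≈⟨ x⁻¹*[x*y]≈y c≉0 _ ⟨
        c ⁻¹ * (c * sumOver g L)           ≈⟨ *-congˡ (sumOver-* c g L) ⟨
        c ⁻¹ * sumOver (λ x → c * g x) L   ≤⟨ *-monoʳ-≤ (⁻¹-nonNeg 0≤c c≉0) (bound L L!) ⟩
        c ⁻¹ * b                           ∎

  HasSum-sumOver : ∀ {G : X → Y → Carrier} {r : X → Carrier} → (∀ x y → 0# ≤ G x y) →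
    (∀ x → HasSum (G x) (r x)) → ∀ L → HasSum (λ y → sumOver (λ x → G x y) L) (sumOver r L)
  HasSum-sumOver 0≤G G-sum []      = HasSum-0
  HasSum-sumOver 0≤G G-sum (x ∷ L) = HasSum-+ (0≤G x)
    (λ y → sumOver-nonNeg (λ x → 0≤G x y) L) (G-sum x) (HasSum-sumOver 0≤G G-sum L)

  module _ {G : X × Y → Carrier} {r : X → Carrier} (0≤G : ∀ p → 0# ≤ G p)
           (G-sum : ∀ x → HasSum (λ y → G (x , y)) (r x)) where
    open ≤-Reasoning

    -- One half of Tonelli: a finite list of pairs lies in the rectangle spanned by its projections.
    pairs≲iterated : G ≲ r
    pairs≲iterated {b} bound P P! = begin
      sumOver G P                                      ≤⟨ sumOver-⊆ 0≤G P! P⊆L×M ⟩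
      sumOver G (cartesianProduct L M)                 ≈⟨ sumOver-cartesianProduct G L M ⟩
      sumOver (λ x → sumOver (λ y → G (x , y)) M) L
        ≤⟨ sumOver-mono (λ x → HasSum.upper (G-sum x) M (deduplicate-! (λ _ _ → em) _)) L ⟩
      sumOver r L                                      ≤⟨ bound L (deduplicate-! (λ _ _ → em) _) ⟩
      b                                                ∎
      where
      L : List X
      L = deduplicate (λ _ _ → em) (mapᴸ proj₁ P)
      M : List Y
      M = deduplicate (λ _ _ → em) (mapᴸ proj₂ P)
      P⊆L×M : ∀ {p} → p ∈ᴸ P → p ∈ᴸ cartesianProduct L M
      P⊆L×M p∈P = ∈-cartesianProduct⁺ (∈-deduplicate⁺ (λ _ _ → em) (∈-map⁺ proj₁ p∈P))
                                      (∈-deduplicate⁺ (λ _ _ → em) (∈-map⁺ proj₂ p∈P))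

    -- The other half of Tonelli: finitely many rows add up to a single family in `y`, whose finite
    -- sums are sums of `G` over rectangles.
    iterated≲pairs : r ≲ G
    iterated≲pairs {b} bound L L! =
      HasSum.least (HasSum-sumOver (λ x y → 0≤G (x , y)) G-sum L) λ M M! → begin
        sumOver (λ y → sumOver (λ x → G (x , y)) L) M   ≈⟨ sumOver-swap (λ x y → G (x , y)) L M ⟨
        sumOver (λ x → sumOver (λ y → G (x , y)) M) L   ≈⟨ sumOver-cartesianProduct G L M ⟨
        sumOver G (cartesianProduct L M)                ≤⟨ bound _ (cartesianProduct⁺ L! M!) ⟩
        b                                               ∎

  ∘-involution-≲ : ∀ {g : X → Carrier} {σ : X → X} → (∀ x → σ (σ x) ≡ x) → g ∘ σ ≲ g
  ∘-involution-≲ {g = g} {σ} σσ bound L L! =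
    ≤-respˡ (sumOver-map g σ L) (bound (mapᴸ σ L) (Unique-map⁺ σ-injective L!))
    where
    σ-injective : ∀ {x y} → σ x ≡ σ y → x ≡ y
    σ-injective {x} {y} σx≡σy = ≡.trans (≡.sym (σσ x)) (≡.trans (≡.cong σ σx≡σy) (σσ y))

  ≲-∘-involution : ∀ {g : X → Carrier} {σ : X → X} → (∀ x → σ (σ x) ≡ x) → g ≲ g ∘ σ
  ≲-∘-involution {g = g} {σ} σσ bound L L! =
    ≤-respˡ (sumOver-cong (λ x → reflexive (≡.cong g (σσ x))) L) (∘-involution-≲ σσ bound L L!)

  module Restriction (Ω : Set) where
    open DiscreteProbability ℝ Ω

    infix 8 _·𝟙_

    -- Product with an indicator: sums over an event become sums over the whole space.
    _·𝟙_ : (Ω → Carrier) → Pred Ω 0ℓ → Ω → Carrier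
    (g ·𝟙 Q) ω with em {Q ω}
    ... | yes _ = g ω
    ... | no  _ = 0#

    ·𝟙-∈ : ∀ g Q {ω} → ω ∈ Q → (g ·𝟙 Q) ω ≈ g ω
    ·𝟙-∈ g Q {ω} ω∈Q with em {Q ω}
    ... | yes _  = refl
    ... | no ω∉Q = contradiction ω∈Q ω∉Q

    ·𝟙-∉ : ∀ g Q {ω} → ω ∉ Q → (g ·𝟙 Q) ω ≈ 0#
    ·𝟙-∉ g Q {ω} ω∉Q with em {Q ω}
    ... | yes ω∈Q = contradiction ω∈Q ω∉Q
    ... | no _    = refl

    ·𝟙-nonNeg : ∀ {g} Q → (∀ ω → 0# ≤ g ω) → ∀ ω → 0# ≤ (g ·𝟙 Q) ω
    ·𝟙-nonNeg Q 0≤g ω with em {Q ω}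
    ... | yes _ = 0≤g ω
    ... | no  _ = ≤-refl

    sumOver-·𝟙 : ∀ g Q L → sumOver (g ·𝟙 Q) L ≈ sumOver g (filter (λ ω → em {Q ω}) L)
    sumOver-·𝟙 g Q []      = refl
    sumOver-·𝟙 g Q (ω ∷ L) with em {Q ω}
    ... | yes _ = +-congˡ (sumOver-·𝟙 g Q L)
    ... | no  _ = trans (+-identityˡ _) (sumOver-·𝟙 g Q L)

    sumOver-·𝟙-All : ∀ g Q {L} → All (_∈ Q) L → sumOver (g ·𝟙 Q) L ≈ sumOver g L
    sumOver-·𝟙-All g Q []          = refl
    sumOver-·𝟙-All g Q (ω∈Q ∷ L⊆Q) = +-cong (·𝟙-∈ g Q ω∈Q) (sumOver-·𝟙-All g Q L⊆Q)

    UpperBound⇒BoundedBy : ∀ {g Q b} → UpperBound (PartialSum Q g) b → BoundedBy (g ·𝟙 Q) b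
    UpperBound⇒BoundedBy {g} {Q} bound L L! = ≤-respˡ (sym (sumOver-·𝟙 g Q L))
      (bound (_ , filter⁺ (λ _ → em) L! , all-filter (λ _ → em) L , refl))

    BoundedBy⇒UpperBound : ∀ {g Q b} → BoundedBy (g ·𝟙 Q) b → UpperBound (PartialSum Q g) b
    BoundedBy⇒UpperBound {g} {Q} bound (L , L! , L⊆Q , s≈) =
      ≤-respˡ (sym (trans s≈ (sym (sumOver-·𝟙-All g Q L⊆Q)))) (bound L L!)

    IsLub⇒HasSum : ∀ {g Q s} → IsLub (PartialSum Q g) s → HasSum (g ·𝟙 Q) s
    IsLub⇒HasSum {g} {Q} (upper , least) = hasSum (UpperBound⇒BoundedBy upper)
      λ bound → least (BoundedBy⇒UpperBound {g} {Q} bound)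

    HasSum-∑⁺ : ∀ {g Q b} → BoundedBy (g ·𝟙 Q) b → HasSum (g ·𝟙 Q) (∑⁺ Q g)
    HasSum-∑⁺ {g} {Q} {b} bound = IsLub⇒HasSum
      (sup-lub (0# , [] , [] , [] , refl) (b , BoundedBy⇒UpperBound {g} {Q} bound))

    ∑⁺-value : ∀ {g Q s} → HasSum (g ·𝟙 Q) s → ∑⁺ Q g ≈ s
    ∑⁺-value gs = HasSum-unique (HasSum-∑⁺ (HasSum.upper gs)) gs

-- Means of nonnegative random variables

module Expectation (em : ExcludedMiddle 0ℓ) (ℝ : RealNumbers) (Ω : Set)
                   (𝒫 : DiscreteProbability.Distribution ℝ Ω) where
  open RealNumbers ℝ
  open RealProperties ℝ
  open Summation em ℝ
  open Restriction Ω
  open DiscreteProbability ℝ Ω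

  private
    variable
      X Y : Ω → Carrier
      s t : Carrier

  mass-nonNeg : ∀ ω → 0# ≤ mass 𝒫 ω
  mass-nonNeg = Distribution.nonNeg 𝒫

  weighted-nonNeg : (∀ ω → 0# ≤ X ω) → ∀ ω → 0# ≤ weighted 𝒫 X ω
  weighted-nonNeg 0≤X ω = *-nonNeg (mass-nonNeg ω) (0≤X ω)

  HasMean : (Ω → Carrier) → Carrier → Set
  HasMean X = HasSum (weighted 𝒫 X)

  ·𝟙-U : ∀ (g : Ω → Carrier) ω → (g ·𝟙 U) ω ≈ g ω
  ·𝟙-U g ω = ·𝟙-∈ g U tt

  HasMean-cong : (∀ ω → X ω ≈ Y ω) → HasMean X s → HasMean Y s
  HasMean-cong X≈Y = HasSum-cong (λ ω → *-congˡ (X≈Y ω))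

  -- Null realizations are exempt from the comparison, which matters because greediness says nothing
  -- about observations of probability zero.
  weighted-mono : (∀ ω → ¬ mass 𝒫 ω ≈ 0# → X ω ≤ Y ω) → ∀ ω → weighted 𝒫 X ω ≤ weighted 𝒫 Y ω
  weighted-mono {X} {Y} X≤Y ω with em {mass 𝒫 ω ≈ 0#}
  ... | no  μ≉0 = *-monoʳ-≤ (mass-nonNeg ω) (X≤Y ω μ≉0)
  ... | yes μ≈0 = ≤-reflexive (trans (0x≈0 (X ω)) (sym (0x≈0 (Y ω))))
    where
    0x≈0 : ∀ x → mass 𝒫 ω * x ≈ 0#
    0x≈0 x = trans (*-congʳ μ≈0) (zeroˡ x)

  HasMean-≤ : (∀ ω → ¬ mass 𝒫 ω ≈ 0# → X ω ≤ Y ω) → HasMean X s → HasMean Y t → s ≤ t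
  HasMean-≤ X≤Y = HasSum-≤ (≤⇒≲ (weighted-mono X≤Y))

  HasMean-+ : (∀ ω → 0# ≤ X ω) → (∀ ω → 0# ≤ Y ω) →
              HasMean X s → HasMean Y t → HasMean (λ ω → X ω + Y ω) (s + t)
  HasMean-+ 0≤X 0≤Y Xs Yt = HasSum-cong (λ ω → sym (distribˡ _ _ _))
    (HasSum-+ (weighted-nonNeg 0≤X) (weighted-nonNeg 0≤Y) Xs Yt)

  HasMean-* : ∀ {c} → 0# ≤ c → HasMean X s → HasMean (λ ω → c * X ω) (c * s)
  HasMean-* 0≤c Xs = HasSum-cong (λ ω → *.x∙yz≈y∙xz _ _ _) (HasSum-* 0≤c Xs)

  HasMean-const : ∀ {c} → 0# ≤ c → HasMean (λ _ → c) c
  HasMean-const {c} 0≤c = HasSum-value (*-identityʳ c) $ HasSum-cong (λ ω → *-comm _ _) $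
    HasSum-* 0≤c $ HasSum-cong (·𝟙-U (mass 𝒫)) $ IsLub⇒HasSum (Distribution.total 𝒫)

  mean : (Ω → Carrier) → Carrier
  mean X = ∑⁺ U (weighted 𝒫 X)

  -- Existence by domination; all later means are obtained in this way.
  HasMean-mean : (∀ ω → X ω ≤ Y ω) → HasMean Y t → HasMean X (mean X)
  HasMean-mean {X} X≤Y Yt = HasSum-cong (·𝟙-U (weighted 𝒫 X)) $ HasSum-∑⁺ $
    ≤⇒≲ (≤-reflexive ∘ ·𝟙-U _) (≤⇒≲ (weighted-mono (λ ω _ → X≤Y ω)) (HasSum.upper Yt))

  ·𝟙-cong : ∀ {g h : Ω → Carrier} → (∀ ω → g ω ≈ h ω) → ∀ Q ω → (g ·𝟙 Q) ω ≈ (h ·𝟙 Q) ω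
  ·𝟙-cong g≈h Q ω with em {Q ω}
  ... | yes _ = g≈h ω
  ... | no  _ = refl

  𝔼-on-value : ∀ {Q} → (∀ ω → 0# ≤ X ω) → HasSum (weighted 𝒫 X ·𝟙 Q) s → 𝔼-on 𝒫 Q X ≈ s
  𝔼-on-value {X} {s} {Q} 0≤X Xs = trans (+-cong posPart-sum (-‿cong negPart-sum)) x-0≈x
    where
    x-0≈x : ∀ {x} → x - 0# ≈ x
    x-0≈x = trans (sym (+-identityʳ _)) (x-y+y≈x _ 0#)
    posPart-sum : ∑⁺ Q (weighted 𝒫 (posPart X)) ≈ s
    posPart-sum = ∑⁺-value $ HasSum-cong
      (·𝟙-cong (λ ω → *-congˡ (sym (x≥y⇒x⊔y≈x (0≤X ω)))) Q) Xs
    negPart-sum : ∑⁺ Q (weighted 𝒫 (negPart X)) ≈ 0#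
    negPart-sum = ∑⁺-value $ HasSum-cong (λ ω → sym (zero-on ω)) HasSum-0
      where
      zero-on : ∀ ω → (weighted 𝒫 (negPart X) ·𝟙 Q) ω ≈ 0#
      zero-on ω with em {Q ω}
      ... | yes _ = trans (*-congˡ (x≤y⇒x⊔y≈y (0≤x⇒-x≤0 (0≤X ω)))) (zeroʳ _)
      ... | no  _ = refl

  𝔼-value : (∀ ω → 0# ≤ X ω) → HasMean X s → 𝔼 𝒫 X ≈ s
  𝔼-value 0≤X Xs = 𝔼-on-value 0≤X (HasSum-cong (sym ∘ ·𝟙-U _) Xs)

  HasExpectation⇒HasMean : (∀ ω → 0# ≤ X ω) → HasExpectation 𝒫 X → HasMean X (mean X)
  HasExpectation⇒HasMean {X} 0≤X ((b , bounded) , _) = HasSum-cong (·𝟙-U _) $ HasSum-∑⁺ $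
    ≤⇒≲ (λ ω → ≤-reflexive (·𝟙-cong (λ ω → *-congˡ (sym (x≥y⇒x⊔y≈x (0≤X ω)))) U ω))
        (UpperBound⇒BoundedBy {Q = U} bounded)

  Prob-sum : ∀ Q → HasSum (mass 𝒫 ·𝟙 Q) (Prob 𝒫 Q)
  Prob-sum Q = HasSum-∑⁺ $ ≤⇒≲ restrict (HasSum.upper (IsLub⇒HasSum (Distribution.total 𝒫)))
    where
    restrict : ∀ ω → (mass 𝒫 ·𝟙 Q) ω ≤ (mass 𝒫 ·𝟙 U) ω
    restrict ω with em {Q ω}
    ... | yes _ = ≤-reflexive (sym (·𝟙-U (mass 𝒫) ω))
    ... | no  _ = ≤-respʳ (sym (·𝟙-U (mass 𝒫) ω)) (mass-nonNeg ω)

  Prob-pos : ∀ {Q ω} → ω ∈ Q → ¬ mass 𝒫 ω ≈ 0# → 0# < Prob 𝒫 Q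
  Prob-pos {Q} {ω} ω∈Q μ≉0 = ≤-trans (mass-nonNeg ω) μ≤Prob , λ 0≈Prob →
    μ≉0 (≤-antisym (≤-respʳ (sym 0≈Prob) μ≤Prob) (mass-nonNeg ω))
    where
    μ≤Prob : mass 𝒫 ω ≤ Prob 𝒫 Q
    μ≤Prob = ≤-respˡ (trans (+-identityʳ _) (·𝟙-∈ (mass 𝒫) Q ω∈Q))
      (HasSum.upper (Prob-sum Q) (ω ∷ []) ([] ∷ []))

-- Finite subsets

module SubsetProperties where

  private
    variable
      n : ℕ
      x y : Fin n
      p q p′ q′ : Subset n

  remove : Fin n → Subset n → Subset n
  remove x p = p Subset.∩ Subset.∁ ⁅ x ⁆

  ∈-remove⁻ : y Subset.∈ remove x p → y Subset.∈ p × y ≢ x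
  ∈-remove⁻ {x = x} {p = p} y∈ with Subset.x∈p∩q⁻ p (Subset.∁ ⁅ x ⁆) y∈
  ... | y∈p , y∈∁x = y∈p , λ { ≡.refl → Subset.x∈∁p⇒x∉p y∈∁x (Subset.x∈⁅x⁆ x) }

  ∈-remove⁺ : y Subset.∈ p → y ≢ x → y Subset.∈ remove x p
  ∈-remove⁺ y∈p y≢x = Subset.x∈p∩q⁺ (y∈p , Subset.x∉p⇒x∈∁p (Subset.x≢y⇒x∉⁅y⁆ y≢x))

  ∪-⊆ : p Subset.⊆ q → p′ Subset.⊆ q → p Subset.∪ p′ Subset.⊆ q
  ∪-⊆ p⊆q p′⊆q = [ p⊆q , p′⊆q ]′ ∘ Subset.x∈p∪q⁻ _ _

  ∪-mono : p Subset.⊆ q → p′ Subset.⊆ q′ → p Subset.∪ p′ Subset.⊆ q Subset.∪ q′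
  ∪-mono {q = q} {q′ = q′} p⊆q p′⊆q′ =
    ∪-⊆ (Subset.p⊆p∪q q′ ∘ p⊆q) (Subset.q⊆p∪q q q′ ∘ p′⊆q′)

  ⁅⁆-⊆ : x Subset.∈ p → ⁅ x ⁆ Subset.⊆ p
  ⁅⁆-⊆ {x = x} x∈p y∈ with ≡.refl ← Subset.x∈⁅y⁆⇒x≡y x y∈ = x∈p

  ∣p∪⁅x⁆∣≤1+∣p∣ : ∀ (p : Subset n) x → ∣ p Subset.∪ ⁅ x ⁆ ∣ ℕ.≤ suc ∣ p ∣
  ∣p∪⁅x⁆∣≤1+∣p∣ (true  ∷ p) zero    rewrite Subset.∪-identityʳ p = ℕ.n≤1+n _
  ∣p∪⁅x⁆∣≤1+∣p∣ (false ∷ p) zero    rewrite Subset.∪-identityʳ p = ℕ.≤-refl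
  ∣p∪⁅x⁆∣≤1+∣p∣ (true  ∷ p) (suc x) = s≤s (∣p∪⁅x⁆∣≤1+∣p∣ p x)
  ∣p∪⁅x⁆∣≤1+∣p∣ (false ∷ p) (suc x) = ∣p∪⁅x⁆∣≤1+∣p∣ p x

  ∣remove∣<∣p∣ : x Subset.∈ p → ∣ remove x p ∣ ℕ.< ∣ p ∣
  ∣remove∣<∣p∣ {x = x} {p = p} x∈p = Subset.p⊂q⇒∣p∣<∣q∣ {p = remove x p}
    (proj₁ ∘ ∈-remove⁻ {x = x} {p = p} , x , x∈p , λ x∈ → proj₂ (∈-remove⁻ {p = p} x∈) ≡.refl)

  ∣p∣≡0⇒p≡⊥ : ∀ (p : Subset n) → ∣ p ∣ ≡ 0 → p ≡ Subset.⊥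
  ∣p∣≡0⇒p≡⊥ []          _  = ≡.refl
  ∣p∣≡0⇒p≡⊥ (false ∷ p) eq = ≡.cong (false ∷_) (∣p∣≡0⇒p≡⊥ p eq)

  ∣p∣≡1⇒p≡⁅x⁆ : ∀ (p : Subset n) → ∣ p ∣ ≡ 1 → ∃[ x ] p ≡ ⁅ x ⁆
  ∣p∣≡1⇒p≡⁅x⁆ (true  ∷ p) eq = zero , ≡.cong (true ∷_) (∣p∣≡0⇒p≡⊥ p (ℕ.suc-injective eq))
  ∣p∣≡1⇒p≡⁅x⁆ (false ∷ p) eq with ∣p∣≡1⇒p≡⁅x⁆ p eq
  ... | x , p≡ = suc x , ≡.cong (false ∷_) p≡

  ∣p∣≡2⇒p≡⁅x⁆∪⁅y⁆ : ∀ (p : Subset n) → ∣ p ∣ ≡ 2 → ∃[ x ] ∃[ y ] p ≡ ⁅ x ⁆ Subset.∪ ⁅ y ⁆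
  ∣p∣≡2⇒p≡⁅x⁆∪⁅y⁆ (true  ∷ p) eq with ∣p∣≡1⇒p≡⁅x⁆ p (ℕ.suc-injective eq)
  ... | y , p≡ = zero , suc y , ≡.cong (true ∷_) (≡.trans p≡ (≡.sym (Subset.∪-identityˡ ⁅ y ⁆)))
  ∣p∣≡2⇒p≡⁅x⁆∪⁅y⁆ (false ∷ p) eq with ∣p∣≡2⇒p≡⁅x⁆∪⁅y⁆ p eq
  ... | x , y , p≡ = suc x , suc y , ≡.cong (false ∷_) p≡

  ∣p∣<∣q∣⇒∃ : ∣ p ∣ ℕ.< ∣ q ∣ → ∃[ x ] (x Subset.∈ q × x Subset.∉ p)
  ∣p∣<∣q∣⇒∃ {p = p} {q} ∣p∣<∣q∣ with Subset.nonempty? (q Subset.∩ Subset.∁ p)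
  ... | yes (x , x∈) with Subset.x∈p∩q⁻ q (Subset.∁ p) x∈
  ...   | x∈q , x∈∁p = x , x∈q , Subset.x∈∁p⇒x∉p x∈∁p
  ∣p∣<∣q∣⇒∃ {p = p} {q} ∣p∣<∣q∣ | no empty =
    contradiction (Subset.p⊆q⇒∣p∣≤∣q∣ q⊆p) (ℕ.<⇒≱ ∣p∣<∣q∣)
    where
    q⊆p : q Subset.⊆ p
    q⊆p {x} x∈q = Subset.x∉∁p⇒x∈p λ x∈∁p → empty (x , Subset.x∈p∩q⁺ (x∈q , x∈∁p))

-- Degrees and the exchange property of the degree constraint

module Degrees (G : Graph) where
  open Graph G
  open SubsetProperties

  neighbours : Subset size → Vertex → Subset order
  neighbours A v = tabulate λ w → does (joins? A v w)

  ∈-neighbours⁻ : ∀ {A v w} → w Subset.∈ neighbours A v → Joins A v w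
  ∈-neighbours⁻ {A} {v} {w} w∈
    with joins? A v w | ≡.trans (≡.sym (lookup∘tabulate (λ w → does (joins? A v w)) w)) ([]=⇒lookup w∈)
  ... | yes joins | _ = joins

  ∈-neighbours⁺ : ∀ {A v w} → Joins A v w → w Subset.∈ neighbours A v
  ∈-neighbours⁺ {A} {v} {w} joins =
    lookup⇒[]= w _ (≡.trans (lookup∘tabulate (λ w → does (joins? A v w)) w) does≡true)
    where
    does≡true : does (joins? A v w) ≡ true
    does≡true with joins? A v w
    ... | yes _  = ≡.refl
    ... | no ¬joins = contradiction joins ¬joins

  ends-pair : ∀ e → ∃[ u ] ∃[ v ] ends e ≡ ⁅ u ⁆ Subset.∪ ⁅ v ⁆
  ends-pair e = ∣p∣≡2⇒p≡⁅x⁆∪⁅y⁆ (ends e) (ends-card e)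

  other-end : ∀ {e v} → v Subset.∈ ends e → ∃[ w ] ends e ≡ ⁅ v ⁆ Subset.∪ ⁅ w ⁆
  other-end {e} {v} v∈e with ends-pair e
  ... | u , w , e≡uw with Subset.x∈p∪q⁻ ⁅ u ⁆ ⁅ w ⁆ (≡.subst (v Subset.∈_) e≡uw v∈e)
  ...   | inj₁ v∈u with ≡.refl ← Subset.x∈⁅y⁆⇒x≡y u v∈u = w , e≡uw
  ...   | inj₂ v∈w with ≡.refl ← Subset.x∈⁅y⁆⇒x≡y w v∈w = u , ≡.trans e≡uw (Subset.∪-comm ⁅ u ⁆ ⁅ w ⁆)

  first∈ends : ∀ {e v w} → ends e ≡ ⁅ v ⁆ Subset.∪ ⁅ w ⁆ → v Subset.∈ ends e
  first∈ends {v = v} {w} e≡vw =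
    ≡.subst (v Subset.∈_) (≡.sym e≡vw) (Subset.p⊆p∪q ⁅ w ⁆ (Subset.x∈⁅x⁆ v))

  other-end-unique : ∀ {e v w x} → ends e ≡ ⁅ v ⁆ Subset.∪ ⁅ w ⁆ → ends e ≡ ⁅ v ⁆ Subset.∪ ⁅ x ⁆ → w ≡ x
  other-end-unique {e} {v} {w} {x} e≡vw e≡vx
    with Subset.x∈p∪q⁻ ⁅ v ⁆ ⁅ x ⁆
      (≡.subst (w Subset.∈_) (≡.trans (≡.sym e≡vw) e≡vx) (Subset.q⊆p∪q ⁅ v ⁆ ⁅ w ⁆ (Subset.x∈⁅x⁆ w)))
  ... | inj₂ w∈x = Subset.x∈⁅y⁆⇒x≡y x w∈x
  ... | inj₁ w∈v with ≡.refl ← Subset.x∈⁅y⁆⇒x≡y v w∈v = contradiction (≡.trans (≡.sym ∣e∣≡1) (ends-card e)) λ ()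
    where
    ∣e∣≡1 : ∣ ends e ∣ ≡ 1
    ∣e∣≡1 = ≡.trans (≡.cong ∣_∣ (≡.trans e≡vw (Subset.∪-idem ⁅ v ⁆))) (Subset.∣⁅x⁆∣≡1 v)

  joins-mono : ∀ {A B v w} → A Subset.⊆ B → Joins A v w → Joins B v w
  joins-mono A⊆B (e , e∈A , e≡vw) = e , A⊆B e∈A , e≡vw

  deg-≤ : ∀ {A v q} → (∀ {w} → Joins A v w → w Subset.∈ q) → deg A v ℕ.≤ ∣ q ∣
  deg-≤ {A} {v} {q} N⊆q = Subset.p⊆q⇒∣p∣≤∣q∣ {p = neighbours A v} {q} (λ w∈ → N⊆q (∈-neighbours⁻ {A} {v} w∈))

  deg-mono : ∀ {A B} v → A Subset.⊆ B → deg A v ℕ.≤ deg B v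
  deg-mono {A} {B} v A⊆B =
    deg-≤ {A} {v} {neighbours B v} λ {w} joins → ∈-neighbours⁺ {B} {v} {w} (joins-mono {A} {B} {v} {w} A⊆B joins)

  -- Adding e to S ∪ T raises the degree of v by at most one, so that it
  -- suffices to drop an edge of T that is incident to v if v is saturated.
  -- When nothing need be dropped, e itself serves as t.
  module _ {S T : Subset size} {e : Edge} (e∉S : e Subset.∉ S) where

    private
      S+e : Subset size
      S+e = S Subset.∪ ⁅ e ⁆

      ∈S+e∪-⁻ : ∀ {i T′} → i Subset.∈ S+e Subset.∪ T′ → i Subset.∈ S ⊎ i ≡ e ⊎ i Subset.∈ T′
      ∈S+e∪-⁻ i∈ with Subset.x∈p∪q⁻ S+e _ i∈
      ... | inj₂ i∈T′ = inj₂ (inj₂ i∈T′)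
      ... | inj₁ i∈S+e with Subset.x∈p∪q⁻ S ⁅ e ⁆ i∈S+e
      ...   | inj₁ i∈S = inj₁ i∈S
      ...   | inj₂ i∈e = inj₂ (inj₁ (Subset.x∈⁅y⁆⇒x≡y e i∈e))

    deg-away : ∀ {T′ v} → v Subset.∉ ends e → T′ Subset.⊆ T → deg (S+e Subset.∪ T′) v ℕ.≤ deg (S Subset.∪ T) v
    deg-away {T′} {v} v∉e T′⊆T = deg-≤ {S+e Subset.∪ T′} {v} (λ joins → ∈-neighbours⁺ (avoid joins))
      where
      avoid : ∀ {w} → Joins (S+e Subset.∪ T′) v w → Joins (S Subset.∪ T) v w
      avoid (i , i∈ , i≡vw) with ∈S+e∪-⁻ i∈
      ... | inj₁ i∈S           = i , Subset.p⊆p∪q T i∈S , i≡vw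
      ... | inj₂ (inj₁ ≡.refl) = contradiction (first∈ends i≡vw) v∉e
      ... | inj₂ (inj₂ i∈T′)   = i , Subset.q⊆p∪q S T (T′⊆T i∈T′) , i≡vw

    exchange-at : ∀ {b v} → v Subset.∈ ends e → deg S+e v ℕ.≤ b → deg (S Subset.∪ T) v ℕ.≤ b →
      ∃[ t ] deg (S+e Subset.∪ remove t T) v ℕ.≤ b
    exchange-at {b} {v} v∈e deg[S+e]≤b deg[S∪T]≤b with other-end v∈e
    ... | x , e≡vx with deg (S Subset.∪ T) v ℕ.<? b
    ...   | yes deg[S∪T]<b = e , (begin
      deg (S+e Subset.∪ remove e T) v
        ≤⟨ deg-≤ {A = S+e Subset.∪ _} {v} from-joins ⟩
      ∣ neighbours (S Subset.∪ T) v Subset.∪ ⁅ x ⁆ ∣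
        ≤⟨ ∣p∪⁅x⁆∣≤1+∣p∣ (neighbours (S Subset.∪ T) v) x ⟩
      suc (deg (S Subset.∪ T) v)
        ≤⟨ deg[S∪T]<b ⟩
      b ∎)
      where
      open ℕ.≤-Reasoning
      from-joins : ∀ {w} → Joins (S+e Subset.∪ remove e T) v w →
        w Subset.∈ neighbours (S Subset.∪ T) v Subset.∪ ⁅ x ⁆
      from-joins (i , i∈ , i≡vw) with ∈S+e∪-⁻ i∈
      ... | inj₁ i∈S = Subset.p⊆p∪q _ (∈-neighbours⁺ (i , Subset.p⊆p∪q T i∈S , i≡vw))
      ... | inj₂ (inj₁ ≡.refl) with ≡.refl ← other-end-unique {i} i≡vw e≡vx =
        Subset.q⊆p∪q _ _ (Subset.x∈⁅x⁆ x)
      ... | inj₂ (inj₂ i∈T′) = Subset.p⊆p∪q _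
        (∈-neighbours⁺ (i , Subset.q⊆p∪q S T (proj₁ (∈-remove⁻ i∈T′)) , i≡vw))
    ...   | no deg[S∪T]≮b = exchange-saturated (∣p∣<∣q∣⇒∃ deg[S]<deg[S∪T])
      where
      open ℕ.≤-Reasoning
      x∉N[S] : x Subset.∉ neighbours S v
      x∉N[S] x∈ with ∈-neighbours⁻ {S} x∈
      ... | i , i∈S , i≡vx with ≡.refl ← ends-injective (≡.trans i≡vx (≡.sym e≡vx)) = e∉S i∈S
      deg[S]<deg[S+e] : deg S v ℕ.< deg S+e v
      deg[S]<deg[S+e] = Subset.p⊂q⇒∣p∣<∣q∣
        ( ∈-neighbours⁺ ∘ joins-mono (Subset.p⊆p∪q ⁅ e ⁆) ∘ ∈-neighbours⁻ {S}
        , x , ∈-neighbours⁺ (e , Subset.q⊆p∪q S ⁅ e ⁆ (Subset.x∈⁅x⁆ e) , e≡vx) , x∉N[S])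
      -- The new edge raises the degree of `v` above `deg S v` and still respects `b`, which `S ∪ T`
      -- attains. So `S ∪ T` has a neighbour of `v` that `S` lacks, and the edge leading to it is
      -- the one to drop.
      deg[S]<deg[S∪T] : deg S v ℕ.< deg (S Subset.∪ T) v
      deg[S]<deg[S∪T] =
        ℕ.<-≤-trans deg[S]<deg[S+e] (ℕ.≤-trans deg[S+e]≤b (ℕ.≮⇒≥ deg[S∪T]≮b))
      exchange-saturated :
        ∃[ w ] (w Subset.∈ neighbours (S Subset.∪ T) v × w Subset.∉ neighbours S v) →
        ∃[ t ] deg (S+e Subset.∪ remove t T) v ℕ.≤ b
      exchange-saturated (w , w∈N[S∪T] , w∉N[S]) with ∈-neighbours⁻ {S Subset.∪ T} w∈N[S∪T]
      ... | t , t∈ , t≡vw = t , (begin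
        deg (S+e Subset.∪ remove t T) v
          ≤⟨ deg-≤ {A = S+e Subset.∪ _} {v} from-joins ⟩
        ∣ remove w N Subset.∪ ⁅ x ⁆ ∣
          ≤⟨ ∣p∪⁅x⁆∣≤1+∣p∣ (remove w N) x ⟩
        suc ∣ remove w N ∣
          ≤⟨ ∣remove∣<∣p∣ w∈N[S∪T] ⟩
        deg (S Subset.∪ T) v
          ≤⟨ deg[S∪T]≤b ⟩
        b ∎)
        where
        N : Subset order
        N = neighbours (S Subset.∪ T) v
        -- Without `e` the neighbour `w` is lost: no edge of `S` joins `v` to it, and in a simple
        -- graph `t` is the only edge that does. Then `e` contributes at most `x`.
        from-joins : ∀ {y} → Joins (S+e Subset.∪ remove t T) v y → y Subset.∈ remove w N Subset.∪ ⁅ x ⁆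
        from-joins (i , i∈ , i≡vy) with ∈S+e∪-⁻ i∈
        ... | inj₁ i∈S = Subset.p⊆p∪q _ $ ∈-remove⁺
          (∈-neighbours⁺ (i , Subset.p⊆p∪q T i∈S , i≡vy))
          λ { ≡.refl → w∉N[S] (∈-neighbours⁺ (i , i∈S , i≡vy)) }
        ... | inj₂ (inj₁ ≡.refl) with ≡.refl ← other-end-unique {i} i≡vy e≡vx =
          Subset.q⊆p∪q _ _ (Subset.x∈⁅x⁆ x)
        ... | inj₂ (inj₂ i∈T′) with ∈-remove⁻ i∈T′
        ...   | i∈T , i≢t = Subset.p⊆p∪q _ $ ∈-remove⁺
          (∈-neighbours⁺ (i , Subset.q⊆p∪q S T i∈T , i≡vy))
          λ { ≡.refl → i≢t (ends-injective (≡.trans i≡vy (≡.sym t≡vw))) }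

    -- Each end of `e` asks for one removal, and the removal made for the other end can only lower
    -- its degree. Feasible sets are thus 2-extendible, which is the origin of the 2 in the ratio.
    exchange : ∀ {b : Vertex → ℕ} → (∀ v → deg S+e v ℕ.≤ b v) → (∀ v → deg (S Subset.∪ T) v ℕ.≤ b v) →
      ∃[ t₁ ] ∃[ t₂ ] ∀ v → deg (S+e Subset.∪ remove t₂ (remove t₁ T)) v ℕ.≤ b v
    exchange {b} deg[S+e]≤b deg[S∪T]≤b with ends-pair e
    ... | u , v , e≡uv
      with exchange-at (first∈ends e≡uv) (deg[S+e]≤b u) (deg[S∪T]≤b u)
         | exchange-at (first∈ends (≡.trans e≡uv (Subset.∪-comm ⁅ u ⁆ ⁅ v ⁆)))
                       (deg[S+e]≤b v) (deg[S∪T]≤b v)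
    ...   | t₁ , at-u | t₂ , at-v = t₁ , t₂ , bounded
      where
      T′ : Subset size
      T′ = remove t₂ (remove t₁ T)
      bounded : ∀ w → deg (S+e Subset.∪ T′) w ℕ.≤ b w
      bounded w with w Subset.∈? ends e
      ... | no w∉e = ℕ.≤-trans
        (deg-away w∉e (proj₁ ∘ ∈-remove⁻ {p = T} ∘ proj₁ ∘ ∈-remove⁻)) (deg[S∪T]≤b w)
      ... | yes w∈e with Subset.x∈p∪q⁻ ⁅ u ⁆ ⁅ v ⁆ (≡.subst (w Subset.∈_) e≡uv w∈e)
      ...   | inj₁ w∈u with ≡.refl ← Subset.x∈⁅y⁆⇒x≡y u w∈u =
        ℕ.≤-trans (deg-mono w (∪-mono {p = S+e} id (proj₁ ∘ ∈-remove⁻))) at-u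
      ...   | inj₂ w∈v with ≡.refl ← Subset.x∈⁅y⁆⇒x≡y v w∈v =
        ℕ.≤-trans (deg-mono w (∪-mono {p = S+e} id T′⊆)) at-v
        where
        T′⊆ : T′ Subset.⊆ remove t₂ T
        T′⊆ i∈ with ∈-remove⁻ i∈
        ... | i∈′ , i≢t₂ = ∈-remove⁺ (proj₁ (∈-remove⁻ i∈′)) i≢t₂

-- Additive weights on subsets

module Weight (ℝ : RealNumbers) where
  open RealNumbers ℝ hiding (zero)
  open RealProperties ℝ
  open SubsetProperties

  private
    variable
      n : ℕ

  weight : (Fin n → Carrier) → Subset n → Carrier
  weight w []      = 0#
  weight w (b ∷ p) = (if b then w zero else 0#) + weight (w ∘ suc) p

  weight-insert : ∀ (w : Fin n → Carrier) p {x} → x Subset.∉ p → weight w (p Subset.∪ ⁅ x ⁆) ≈ weight w p + w x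
  weight-insert w (true  ∷ p) {zero}  x∉ = contradiction here x∉
  weight-insert w (false ∷ p) {zero}  x∉ rewrite Subset.∪-identityʳ p =
    trans (+-comm _ _) (+-congʳ (sym (+-identityˡ _)))
  weight-insert w (true  ∷ p) {suc x} x∉ =
    trans (+-congˡ (weight-insert (w ∘ suc) p (x∉ ∘ there))) (sym (+-assoc _ _ _))
  weight-insert w (false ∷ p) {suc x} x∉ =
    trans (+-congˡ (weight-insert (w ∘ suc) p (x∉ ∘ there))) (sym (+-assoc _ _ _))

  weight-mono : ∀ {w : Fin n → Carrier} → (∀ x → 0# ≤ w x) → ∀ {p q} → p Subset.⊆ q → weight w p ≤ weight w q
  weight-mono 0≤w {[]}        {[]}        p⊆q = ≤-refl
  weight-mono 0≤w {false ∷ p} {false ∷ q} p⊆q = +-monoʳ-≤ _ (weight-mono (0≤w ∘ suc) (Subset.drop-∷-⊆ p⊆q))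
  weight-mono 0≤w {false ∷ p} {true  ∷ q} p⊆q = +-mono-≤ (0≤w zero) (weight-mono (0≤w ∘ suc) (Subset.drop-∷-⊆ p⊆q))
  weight-mono 0≤w {true  ∷ p} {true  ∷ q} p⊆q = +-monoʳ-≤ _ (weight-mono (0≤w ∘ suc) (Subset.drop-∷-⊆ p⊆q))
  weight-mono 0≤w {true  ∷ p} {false ∷ q} p⊆q = contradiction (p⊆q here) λ ()

  weight-zero : ∀ {w : Fin n → Carrier} p → (∀ {x} → x Subset.∈ p → w x ≈ 0#) → weight w p ≈ 0#
  weight-zero []          w≈0 = refl
  weight-zero (true  ∷ p) w≈0 = trans (+-cong (w≈0 here) (weight-zero p (w≈0 ∘ there))) (+-identityˡ 0#)
  weight-zero (false ∷ p) w≈0 = trans (+-congˡ (weight-zero p (w≈0 ∘ there))) (+-identityˡ 0#)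

  -- `x` may lie outside `p`, where nothing is lost and `0 ≤ g` suffices; this covers an exchange
  -- that drops no edge.
  weight-remove : ∀ {w : Fin n → Carrier} {g} → (∀ x → 0# ≤ w x) → 0# ≤ g → ∀ {p} x →
    (∀ {y} → y Subset.∈ p → w y ≤ g) → weight w p ≤ weight w (remove x p) + g
  weight-remove {w = w} {g} 0≤w 0≤g {p} x w≤g with x Subset.∈? p
  ... | no x∉p = ≤-trans
    (weight-mono 0≤w {p} {remove x p} λ y∈p → ∈-remove⁺ y∈p λ { ≡.refl → x∉p y∈p }) (x≤x+y 0≤g)
  ... | yes x∈p = begin
    weight w p                              ≤⟨ weight-mono 0≤w p⊆ ⟩
    weight w (remove x p Subset.∪ ⁅ x ⁆)    ≈⟨ weight-insert w (remove x p) (λ x∈ → proj₂ (∈-remove⁻ {p = p} x∈) ≡.refl) ⟩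
    weight w (remove x p) + w x             ≤⟨ +-monoʳ-≤ _ (w≤g x∈p) ⟩
    weight w (remove x p) + g               ∎
    where
    open ≤-Reasoning
    p⊆ : p Subset.⊆ remove x p Subset.∪ ⁅ x ⁆
    p⊆ {y} y∈p with y Subset.∈? ⁅ x ⁆
    ... | yes y∈x = Subset.q⊆p∪q (remove x p) ⁅ x ⁆ y∈x
    ... | no y∉x  = Subset.p⊆p∪q ⁅ x ⁆ (∈-remove⁺ y∈p (Subset.x∉⁅y⁆⇒x≢y y∉x))

-- Runs of policies as adapted processes

module Policies (ℝ : RealNumbers) (G : Graph) (d : Graph.Vertex G → ℕ) (O : Set) where
  open Graph G
  open Matchmaking ℝ G d O
  open SubsetProperties

  ∈dom⇒just : ∀ Ψ {i} → i Subset.∈ dom Ψ → ∃[ o ] lookup Ψ i ≡ just o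
  ∈dom⇒just Ψ {i} i∈ with lookup Ψ i | ≡.trans (≡.sym (lookup-map i is-just Ψ)) ([]=⇒lookup i∈)
  ... | just o | _ = o , ≡.refl

  just⇒∈dom : ∀ Ψ {i o} → lookup Ψ i ≡ just o → i Subset.∈ dom Ψ
  just⇒∈dom Ψ {i} eq =
    lookup⇒[]= i (dom Ψ) (≡.trans (lookup-map i is-just Ψ) (≡.cong is-just eq))

  ∼-agree : ∀ Ψ {Φ Φ′} → Φ ∼ Ψ → Φ′ ∼ Ψ → ∀ {i} → i Subset.∈ dom Ψ → lookup Φ i ≡ lookup Φ′ i
  ∼-agree Ψ Φ∼Ψ Φ′∼Ψ i∈ with ∈dom⇒just Ψ i∈
  ... | o , Ψi = ≡.trans (Φ∼Ψ Ψi) (≡.sym (Φ′∼Ψ Ψi))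

  update-agrees : ∀ {A : Subset size} {e} → e Subset.∉ A → ∀ (Φ : Realization) o →
    ∀ {i} → i Subset.∈ A → lookup (Φ [ e ]≔ o) i ≡ lookup Φ i
  update-agrees e∉A Φ o i∈A = lookup∘update′ (λ { ≡.refl → e∉A i∈A }) Φ o

  ∼-update : ∀ Ψ {e Φ} → e Subset.∉ dom Ψ → ∀ o → (Φ [ e ]≔ o ∼ Ψ → Φ ∼ Ψ) × (Φ ∼ Ψ → Φ [ e ]≔ o ∼ Ψ)
  ∼-update Ψ {e} {Φ} e∉ o =
    (λ Φ′∼Ψ {i} Ψi → ≡.trans (≡.sym (agree (just⇒∈dom Ψ {i} Ψi))) (Φ′∼Ψ Ψi)) ,
    (λ Φ∼Ψ {i} Ψi → ≡.trans (agree (just⇒∈dom Ψ {i} Ψi)) (Φ∼Ψ Ψi))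
    where
    agree : ∀ {i} → i Subset.∈ dom Ψ → lookup (Φ [ e ]≔ o) i ≡ lookup Φ i
    agree = update-agrees e∉ Φ o

  insert : Maybe Edge → Subset size → Subset size
  insert nothing  A = A
  insert (just e) A = A Subset.∪ ⁅ e ⁆

  Fresh : Maybe Edge → Subset size → Set
  Fresh c A = ∀ {e} → c ≡ just e → e Subset.∉ A

  -- What resampling requires of a run: a picked item is new, and changing its outcome alters
  -- neither the pick nor the set to which it is added. This takes the place of a filtration.
  record Process : Set where
    field
      current : ℕ → Realization → Subset size
      pick    : ℕ → Realization → Maybe Edge
      advance : ∀ k Φ → current (suc k) Φ ≡ insert (pick k Φ) (current k Φ)
      fresh   : ∀ k Φ → Fresh (pick k Φ) (current k Φ)
      adapted : ∀ k {Φ e} o → pick k Φ ≡ just e →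
                pick k (Φ [ e ]≔ o) ≡ just e × current k (Φ [ e ]≔ o) ≡ current k Φ

  []≔true : ∀ {n} (p : Subset n) x → p [ x ]≔ true ≡ p Subset.∪ ⁅ x ⁆
  []≔true (b     ∷ p) zero    = ≡.cong₂ _∷_ (≡.sym (∨-zeroʳ b)) (≡.sym (Subset.∪-identityʳ p))
  []≔true (true  ∷ p) (suc x) = ≡.cong (true ∷_) ([]≔true p x)
  []≔true (false ∷ p) (suc x) = ≡.cong (false ∷_) ([]≔true p x)

  dom-∅ : ∀ {e} → e Subset.∉ dom ∅
  dom-∅ {e} e∈ with ∈dom⇒just ∅ e∈
  ... | o , eq with () ← ≡.trans (≡.sym (lookup-replicate e nothing)) eq

  dom-update : ∀ Ψ e {o} → dom (Ψ [ e ]≔ just o) ≡ dom Ψ Subset.∪ ⁅ e ⁆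
  dom-update Ψ e = ≡.trans (map-[]≔ is-just Ψ e) ([]≔true (dom Ψ) e)

  module _ (π : Policy) where

    chosen : Realization → ℕ → Maybe Edge
    chosen Φ k = choose π (run π Φ k)

    run-stop : ∀ Φ k → chosen Φ k ≡ nothing → run π Φ (suc k) ≡ run π Φ k
    run-stop Φ k eq rewrite eq = ≡.refl

    run-select : ∀ Φ k {e} → chosen Φ k ≡ just e →
      run π Φ (suc k) ≡ run π Φ k [ e ]≔ just (lookup Φ e)
    run-select Φ k eq rewrite eq = ≡.refl

    dom-run-select : ∀ Φ k {e} → chosen Φ k ≡ just e →
      dom (run π Φ (suc k)) ≡ dom (run π Φ k) Subset.∪ ⁅ e ⁆
    dom-run-select Φ k {e} eq = ≡.trans (≡.cong dom (run-select Φ k eq)) (dom-update (run π Φ k) e)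

    dom-run-mono : ∀ Φ k → dom (run π Φ k) Subset.⊆ dom (run π Φ (suc k))
    dom-run-mono Φ k {i} i∈ with chosen Φ k in eq
    ... | nothing = i∈
    ... | just e  =
      ≡.subst (i Subset.∈_) (≡.sym (dom-update (run π Φ k) e)) (Subset.p⊆p∪q ⁅ e ⁆ i∈)

    dom-run-≤ : ∀ Φ {j k} → j ℕ.≤ k → dom (run π Φ j) Subset.⊆ dom (run π Φ k)
    dom-run-≤ Φ = go ∘ ℕ.≤⇒≤′
      where
      go : ∀ {j k} → j ℕ.≤′ k → dom (run π Φ j) Subset.⊆ dom (run π Φ k)
      go (ℕ.≤′-reflexive ≡.refl)     = id
      go (ℕ.≤′-step {k} j≤k) = dom-run-mono Φ k ∘ go j≤k

    run-consistent : ∀ Φ k → Φ ∼ run π Φ k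
    run-consistent Φ zero {e} eq with () ← ≡.trans (≡.sym (lookup-replicate e nothing)) eq
    run-consistent Φ (suc k) {i} eq with chosen Φ k
    ... | nothing = run-consistent Φ k eq
    ... | just e with i ≟ e
    ...   | yes ≡.refl
      with ≡.refl ← ≡.trans (≡.sym (lookup∘update i (run π Φ k) (just (lookup Φ i)))) eq = ≡.refl
    ...   | no i≢e = run-consistent Φ k
      (≡.trans (≡.sym (lookup∘update′ i≢e (run π Φ k) (just (lookup Φ e)))) eq)

    -- The run has not yet looked at `e`, so it meets the same outcomes and repeats its choices.
    run-update : ∀ Φ k {e} o → e Subset.∉ dom (run π Φ k) → run π (Φ [ e ]≔ o) k ≡ run π Φ k
    run-update Φ zero        o e∉ = ≡.refl
    run-update Φ (suc k) {e} o e∉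
      rewrite run-update Φ k o (e∉ ∘ dom-run-mono Φ k) with chosen Φ k in eq
    ... | nothing = ≡.refl
    ... | just i  = ≡.cong (λ o → run π Φ k [ i ]≔ just o) (lookup∘update′ i≢e Φ o)
      where
      i≢e : i ≢ e
      i≢e ≡.refl = e∉ (just⇒∈dom (run π Φ k [ i ]≔ just (lookup Φ i)) (lookup∘update i (run π Φ k) _))

  -- A policy may select an item whose outcome is already fixed by the past. Such a selection adds
  -- nothing, and no fresh outcome may be drawn for it, so it must not count as a pick.
  newly : Subset size → Maybe Edge → Maybe Edge
  newly A nothing  = nothing
  newly A (just e) with e Subset.∈? A
  ... | yes _ = nothing
  ... | no  _ = just e

  newly-just : ∀ A c {e} → newly A c ≡ just e → c ≡ just e × e Subset.∉ A
  newly-just A (just e) eq with e Subset.∈? A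
  ... | no e∉A with ≡.refl ← eq = ≡.refl , e∉A

  newly-∉ : ∀ {A e} → e Subset.∉ A → newly A (just e) ≡ just e
  newly-∉ {A} {e} e∉A with e Subset.∈? A
  ... | yes e∈A = contradiction e∈A e∉A
  ... | no  _   = ≡.refl

  insert-newly : ∀ A c → insert (newly A c) A ≡ insert c A
  insert-newly A nothing  = ≡.refl
  insert-newly A (just e) with e Subset.∈? A
  ... | yes e∈A = Subset.⊆-antisym (Subset.p⊆p∪q ⁅ e ⁆) (∪-⊆ id (⁅⁆-⊆ e∈A))
  ... | no  _   = ≡.refl

  -- π is run from scratch, ignoring what is already known about B Φ; only
  -- the selections that are new relative to B Φ count as picks.
  follow : (B : Realization → Subset size) →
    (∀ Φ {e} o → e Subset.∉ B Φ → B (Φ [ e ]≔ o) ≡ B Φ) → Policy → Process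
  follow B B-update π = record
    { current = union
    ; pick    = new
    ; advance = advances
    ; fresh   = λ k Φ eq → proj₂ (newly-just (union k Φ) (chosen π Φ k) eq)
    ; adapted = adapts
    }
    where
    union : ℕ → Realization → Subset size
    union k Φ = B Φ Subset.∪ dom (run π Φ k)
    new : ℕ → Realization → Maybe Edge
    new k Φ = newly (union k Φ) (chosen π Φ k)
    advances : ∀ k Φ → union (suc k) Φ ≡ insert (new k Φ) (union k Φ)
    advances k Φ rewrite insert-newly (union k Φ) (chosen π Φ k) with chosen π Φ k in eq
    ... | nothing = ≡.refl
    ... | just e  = ≡.trans
      (≡.cong (B Φ Subset.∪_) (dom-update (run π Φ k) e))
      (≡.sym (Subset.∪-assoc (B Φ) (dom (run π Φ k)) ⁅ e ⁆))
    adapts : ∀ k {Φ e} o → new k Φ ≡ just e →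
      new k (Φ [ e ]≔ o) ≡ just e × union k (Φ [ e ]≔ o) ≡ union k Φ
    adapts k {Φ} {e} o eq with newly-just (union k Φ) (chosen π Φ k) eq
    ... | _ , e∉
      rewrite run-update π Φ k o (e∉ ∘ Subset.q⊆p∪q (B Φ) _)
            | B-update Φ o (e∉ ∘ Subset.p⊆p∪q (dom (run π Φ k)))
      = eq , ≡.refl

-- Resampling a single outcome

module Resampling (em : ExcludedMiddle 0ℓ) (ℝ : RealNumbers) (G : Graph)
                  (d : Graph.Vertex G → ℕ) (O : Set)
                  (𝒫 : Matchmaking.Distribution ℝ G d O)
                  (independent : Matchmaking.Independent ℝ G d O 𝒫) where
  open Matchmaking ℝ G d O
  open RealNumbers ℝ
  open RealProperties ℝ
  open Summation em ℝ
  open Graph G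
  open BigOperator *-commutativeMonoid using (∑-distrib-+; sum-cong-≋)
  open Expectation em ℝ Realization 𝒫

  -- By independence both products factor over the items, and the exchange only transposes the two
  -- factors at `e`.
  mass-exchange : ∀ Φ Φ′ e →
    mass 𝒫 (Φ [ e ]≔ lookup Φ′ e) * mass 𝒫 (Φ′ [ e ]≔ lookup Φ e) ≈ mass 𝒫 Φ * mass 𝒫 Φ′
  mass-exchange Φ Φ′ e = begin-equality
    mass 𝒫 Φ₁ * mass 𝒫 Φ₂                              ≈⟨ product Φ₁ Φ₂ ⟩
    ∏ (λ i → P i (lookup Φ₁ i) * P i (lookup Φ₂ i))    ≈⟨ sum-cong-≋ {size} coordinate ⟩
    ∏ (λ i → P i (lookup Φ i) * P i (lookup Φ′ i))     ≈⟨ product Φ Φ′ ⟨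
    mass 𝒫 Φ * mass 𝒫 Φ′                               ∎
    where
    open ≤-Reasoning
    Φ₁ Φ₂ : Realization
    Φ₁ = Φ [ e ]≔ lookup Φ′ e
    Φ₂ = Φ′ [ e ]≔ lookup Φ e
    P : Edge → O → Carrier
    P i o = Prob 𝒫 (λ Φ → lookup Φ i ≡ o)
    product : ∀ Φ Φ′ → mass 𝒫 Φ * mass 𝒫 Φ′ ≈ ∏ (λ i → P i (lookup Φ i) * P i (lookup Φ′ i))
    product Φ Φ′ = trans (*-cong (independent Φ) (independent Φ′))
      (sym (∑-distrib-+ {size} (λ i → P i (lookup Φ i)) (λ i → P i (lookup Φ′ i))))
    coordinate : ∀ i → P i (lookup Φ₁ i) * P i (lookup Φ₂ i) ≈ P i (lookup Φ i) * P i (lookup Φ′ i)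
    coordinate i with i ≟ e
    ... | yes ≡.refl
      rewrite lookup∘update i Φ (lookup Φ′ i) | lookup∘update i Φ′ (lookup Φ i) = *-comm _ _
    ... | no i≢e
      rewrite lookup∘update′ i≢e Φ (lookup Φ′ e) | lookup∘update′ i≢e Φ′ (lookup Φ e) = refl

  -- The coordinate to be resampled may depend on Φ, but not on its own
  -- outcome. Exchanging it between Φ and an independent copy Φ′ is therefore
  -- an involution, and by independence it preserves the product distribution.
  module _ (c : Realization → Maybe Edge)
           (c-stable : ∀ {Φ e} o → c Φ ≡ just e → c (Φ [ e ]≔ o) ≡ just e) where

    exchange : Maybe Edge → Realization × Realization → Realization × Realization
    exchange nothing  p        = p
    exchange (just e) (Φ , Φ′) = Φ [ e ]≔ lookup Φ′ e , Φ′ [ e ]≔ lookup Φ e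

    σ : Realization × Realization → Realization × Realization
    σ (Φ , Φ′) = exchange (c Φ) (Φ , Φ′)

    σ-involutive : ∀ p → σ (σ p) ≡ p
    σ-involutive (Φ , Φ′) with c Φ in cΦ
    ... | nothing rewrite cΦ = ≡.refl
    ... | just e
      rewrite c-stable (lookup Φ′ e) cΦ
            | lookup∘update e Φ (lookup Φ′ e) | lookup∘update e Φ′ (lookup Φ e)
            | []≔-idempotent {x = lookup Φ′ e} {y = lookup Φ e} Φ e
            | []≔-idempotent {x = lookup Φ e} {y = lookup Φ′ e} Φ′ e
            | []≔-lookup Φ e | []≔-lookup Φ′ e = ≡.refl

    -- In `K Φ Φ′` the history comes from `Φ` and the outcome of the picked item from `Φ′`. By
    -- Tonelli, `G₁` sums to the mean of the diagonal of `K` and `G₂` to the mean of `D`; `σ`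
    -- carries one family to the other, so the mean of `D` exists too.
    resample : ∀ {K : Realization → Realization → Carrier} {D s} →
      (∀ Φ Φ′ → 0# ≤ K Φ Φ′) →
      (∀ {Φ} Φ′ → c Φ ≡ nothing → K Φ Φ ≈ K Φ Φ′) →
      (∀ {Φ e} Φ′ → c Φ ≡ just e →
       K (Φ [ e ]≔ lookup Φ′ e) (Φ [ e ]≔ lookup Φ′ e) ≈ K Φ Φ′) →
      (∀ Φ → HasMean (K Φ) (D Φ)) →
      HasMean (λ Φ → K Φ Φ) s → HasMean D s
    resample {K} {D} {s} 0≤K K-nothing K-just K-mean =
      HasSum-resp unsampled≲resampled resampled≲unsampled
      where
      G₁ G₂ : Realization × Realization → Carrier
      G₁ (Φ , Φ′) = (mass 𝒫 Φ * mass 𝒫 Φ′) * K Φ Φ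
      G₂ (Φ , Φ′) = (mass 𝒫 Φ * mass 𝒫 Φ′) * K Φ Φ′
      0≤G₁ : ∀ p → 0# ≤ G₁ p
      0≤G₁ (Φ , Φ′) = *-nonNeg (*-nonNeg (mass-nonNeg Φ) (mass-nonNeg Φ′)) (0≤K Φ Φ)
      0≤G₂ : ∀ p → 0# ≤ G₂ p
      0≤G₂ (Φ , Φ′) = *-nonNeg (*-nonNeg (mass-nonNeg Φ) (mass-nonNeg Φ′)) (0≤K Φ Φ′)
      sum₁ : ∀ Φ → HasSum (λ Φ′ → G₁ (Φ , Φ′)) (mass 𝒫 Φ * K Φ Φ)
      sum₁ Φ = HasSum-cong (λ Φ′ → sym (*-assoc _ _ _)) $
        HasSum-* (mass-nonNeg Φ) (HasMean-const (0≤K Φ Φ))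
      sum₂ : ∀ Φ → HasSum (λ Φ′ → G₂ (Φ , Φ′)) (mass 𝒫 Φ * D Φ)
      sum₂ Φ = HasSum-cong (λ Φ′ → sym (*-assoc _ _ _)) $ HasSum-* (mass-nonNeg Φ) (K-mean Φ)
      G₁σ≈G₂ : ∀ p → G₁ (σ p) ≈ G₂ p
      G₁σ≈G₂ (Φ , Φ′) with c Φ in cΦ
      ... | nothing = *-congˡ (K-nothing Φ′ cΦ)
      ... | just e  = *-cong (mass-exchange Φ Φ′ e) (K-just Φ′ cΦ)
      unsampled≲resampled : weighted 𝒫 (λ Φ → K Φ Φ) ≲ weighted 𝒫 D
      unsampled≲resampled bound = iterated≲pairs 0≤G₁ sum₁ $ ≲-∘-involution σ-involutive $
        ≤⇒≲ (λ p → ≤-reflexive (G₁σ≈G₂ p)) (pairs≲iterated 0≤G₂ sum₂ bound)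
      resampled≲unsampled : weighted 𝒫 D ≲ weighted 𝒫 (λ Φ → K Φ Φ)
      resampled≲unsampled bound = iterated≲pairs 0≤G₂ sum₂ $
        ≤⇒≲ (λ p → ≤-reflexive (sym (G₁σ≈G₂ p))) $
        ∘-involution-≲ σ-involutive (pairs≲iterated 0≤G₁ sum₁ bound)

-- Marginals of the utility

module SubmodularUtility (ℝ : RealNumbers) (G : Graph) (d : Graph.Vertex G → ℕ) (O : Set)
                         (f̂ : SetFunctions.SetFunction ℝ (Graph.Edge G × O))
                         (monotone : SetFunctions.Monotone ℝ f̂)
                         (submodular : SetFunctions.Submodular ℝ f̂) where
  open Matchmaking ℝ G d O
  open RealNumbers ℝ
  open RealProperties ℝ
  open Graph G
  open Policies ℝ G d O

  graph : Subset size → Realization → Pred (Edge × O) 0ℓ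
  graph A Φ (e , o) = e Subset.∈ A × lookup Φ e ≡ o

  graph-⊆ : ∀ {A B Φ Φ′} → A Subset.⊆ B → (∀ {i} → i Subset.∈ A → lookup Φ i ≡ lookup Φ′ i) →
            graph A Φ ⊆ graph B Φ′
  graph-⊆ A⊆B agree (i∈A , Φi≡o) = A⊆B i∈A , ≡.trans (≡.sym (agree i∈A)) Φi≡o

  graph-insert : ∀ A e Φ → graph (A Subset.∪ ⁅ e ⁆) Φ ≐ graph A Φ ∪ ｛ e , lookup Φ e ｝
  graph-insert A e Φ = to , [ graph-⊆ {Φ = Φ} {Φ} (Subset.p⊆p∪q {p = A} ⁅ e ⁆) (λ _ → ≡.refl)
                            , (λ { ≡.refl → Subset.q⊆p∪q A ⁅ e ⁆ (Subset.x∈⁅x⁆ e) , ≡.refl }) ]′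
    where
    to : graph (A Subset.∪ ⁅ e ⁆) Φ ⊆ graph A Φ ∪ ｛ e , lookup Φ e ｝
    to (i∈ , Φi≡o) with Subset.x∈p∪q⁻ A ⁅ e ⁆ i∈
    ... | inj₁ i∈A = inj₁ (i∈A , Φi≡o)
    ... | inj₂ i∈e with Subset.x∈⁅y⁆⇒x≡y e i∈e
    ... | ≡.refl = inj₂ (≡.cong (e ,_) Φi≡o)

  f : Utility
  f = utility f̂

  f-nonNeg : ∀ A Φ → 0# ≤ f A Φ
  f-nonNeg A Φ = SetFunction.nonNeg f̂ _

  f̂-mono-list : ∀ Q L → apply f̂ Q ≤ apply f̂ (Q ∪ (_∈ᴸ L))
  f̂-mono-list Q []      = ≤-reflexive (SetFunction.cong f̂ (inj₁ , [ id , (λ ()) ]′))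
  f̂-mono-list Q (x ∷ L) = begin
    apply f̂ Q                              ≤⟨ 0≤y-x⇒x≤y (monotone Q x) ⟩
    apply f̂ (Q ∪ ｛ x ｝)                  ≤⟨ f̂-mono-list (Q ∪ ｛ x ｝) L ⟩
    apply f̂ ((Q ∪ ｛ x ｝) ∪ (_∈ᴸ L))
      ≈⟨ SetFunction.cong f̂ ([ [ inj₁ , (λ { ≡.refl → inj₂ (here ≡.refl) }) ]′ , inj₂ ∘ there ]′
                           , [ inj₁ ∘ inj₁ , (λ { (here ≡.refl) → inj₁ (inj₂ ≡.refl)
                                                ; (there y∈L) → inj₂ y∈L }) ]′) ⟩
    apply f̂ (Q ∪ (_∈ᴸ (x ∷ L)))            ∎
    where open ≤-Reasoning

  -- `Monotone` adds one point at a time. Under a fixed `Φ` the graph of `B` is finite, so its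
  -- points can be listed and adjoined one after another.
  f-mono : ∀ {A B} Φ → A Subset.⊆ B → f A Φ ≤ f B Φ
  f-mono {A} {B} Φ A⊆B = ≤-respʳ (SetFunction.cong f̂ (to , from)) (f̂-mono-list (graph A Φ) L)
    where
    L : List (Edge × O)
    L = mapᴸ (λ e → e , lookup Φ e) (filter (Subset._∈? B) (allFin size))
    to : graph A Φ ∪ (_∈ᴸ L) ⊆ graph B Φ
    to (inj₁ (e∈A , Φe≡o)) = A⊆B e∈A , Φe≡o
    to (inj₂ p∈L) with ∈-map⁻ _ p∈L
    ... | e , e∈ , ≡.refl = proj₂ (∈-filter⁻ (Subset._∈? B) {xs = allFin size} e∈) , ≡.refl
    from : graph B Φ ⊆ graph A Φ ∪ (_∈ᴸ L)
    from (e∈B , ≡.refl) = inj₂ (∈-map⁺ _ (∈-filter⁺ (Subset._∈? B) (∈-allFin _) e∈B))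

  -- The outcome is an argument of its own, so that it can be drawn independently of the realization
  -- that supplies the history on `A`.
  marginal : Subset size → Edge → Realization → O → Carrier
  marginal A e Φ o = apply f̂ (graph A Φ ∪ ｛ e , o ｝) - f A Φ

  marginal-nonNeg : ∀ A e Φ o → 0# ≤ marginal A e Φ o
  marginal-nonNeg A e Φ o = monotone (graph A Φ) (e , o)

  -- Agreement on `A` already embeds one graph in the other, and `e ∉ B` makes the added point new
  -- whatever its outcome.
  marginal-antitone : ∀ {A B e} Φ Φ′ o → A Subset.⊆ B → e Subset.∉ B →
    (∀ {i} → i Subset.∈ A → lookup Φ i ≡ lookup Φ′ i) → marginal B e Φ′ o ≤ marginal A e Φ o
  marginal-antitone {A} {B} Φ Φ′ o A⊆B e∉B agree =
    submodular (graph A Φ) (graph B Φ′) (_ , o) (graph-⊆ {Φ = Φ} {Φ′} A⊆B agree) (e∉B ∘ proj₁)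

  marginal-local : ∀ {A e} Φ Φ′ o → e Subset.∉ A →
    (∀ {i} → i Subset.∈ A → lookup Φ i ≡ lookup Φ′ i) → marginal A e Φ o ≈ marginal A e Φ′ o
  marginal-local Φ Φ′ o e∉A agree = ≤-antisym
    (marginal-antitone Φ′ Φ o id e∉A (≡.sym ∘ agree)) (marginal-antitone Φ Φ′ o id e∉A agree)

  f-insert : ∀ A e Φ → f (A Subset.∪ ⁅ e ⁆) Φ ≈ f A Φ + marginal A e Φ (lookup Φ e)
  f-insert A e Φ =
    trans (SetFunction.cong f̂ (graph-insert A e Φ)) (sym (y+[x-y]≈x _ (f A Φ)))

  -- Supplies an integrable majorant that does not depend on the history: submodularity reduces to
  -- the empty set, and `f` is nonnegative there.
  marginal≤f⁅e⁆ : ∀ {A e} Φ Φ′ → e Subset.∉ A → marginal A e Φ (lookup Φ′ e) ≤ f ⁅ e ⁆ Φ′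
  marginal≤f⁅e⁆ {A} {e} Φ Φ′ e∉A = begin
    marginal A e Φ (lookup Φ′ e)
      ≤⟨ marginal-antitone Φ′ Φ (lookup Φ′ e) Subset.⊥⊆ e∉A (λ i∈⊥ → contradiction i∈⊥ Subset.∉⊥) ⟩
    marginal Subset.⊥ e Φ′ (lookup Φ′ e)
      ≤⟨ y≤x+y (f-nonNeg Subset.⊥ Φ′) ⟩
    f Subset.⊥ Φ′ + marginal Subset.⊥ e Φ′ (lookup Φ′ e)  ≈⟨ f-insert Subset.⊥ e Φ′ ⟨
    f (Subset.⊥ Subset.∪ ⁅ e ⁆) Φ′
      ≡⟨ ≡.cong (λ A → f A Φ′) (Subset.∪-identityˡ ⁅ e ⁆) ⟩
    f ⁅ e ⁆ Φ′                                            ∎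
    where open ≤-Reasoning

  -- The diagonal is the realised increment of a step; off the diagonal the outcome is a fresh one.
  gain : Maybe Edge → Subset size → Realization → Realization → Carrier
  gain nothing  A Φ Φ′ = 0#
  gain (just e) A Φ Φ′ = marginal A e Φ (lookup Φ′ e)

  gain-nonNeg : ∀ c A Φ Φ′ → 0# ≤ gain c A Φ Φ′
  gain-nonNeg nothing  A Φ Φ′ = ≤-refl
  gain-nonNeg (just e) A Φ Φ′ = marginal-nonNeg A e Φ _

  gain-insert : ∀ c A Φ → f (insert c A) Φ ≈ f A Φ + gain c A Φ Φ
  gain-insert nothing  A Φ = sym (+-identityʳ _)
  gain-insert (just e) A Φ = f-insert A e Φ

-- Expected marginals and compensators

module Benefits
  (em : ExcludedMiddle 0ℓ) (ℝ : RealNumbers) (G : Graph) (d : Graph.Vertex G → ℕ) (O : Set)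
  (𝒫 : Matchmaking.Distribution ℝ G d O) (independent : Matchmaking.Independent ℝ G d O 𝒫)
  (f̂ : SetFunctions.SetFunction ℝ (Graph.Edge G × O))
  (monotone : SetFunctions.Monotone ℝ f̂) (submodular : SetFunctions.Submodular ℝ f̂)
  (integrable : ∀ A →
    Matchmaking.HasExpectation ℝ G d O 𝒫 (Matchmaking.utility ℝ G d O f̂ A)) where
  open Matchmaking ℝ G d O
  open RealNumbers ℝ
  open RealProperties ℝ
  open Graph G
  open Summation em ℝ
  open Restriction Realization
  open Expectation em ℝ Realization 𝒫
  open Resampling em ℝ G d O 𝒫 independent
  open Policies ℝ G d O
  open SubmodularUtility ℝ G d O f̂ monotone submodular

  f-mean : ∀ A → HasMean (f A) (mean (f A))
  f-mean A = HasExpectation⇒HasMean (f-nonNeg A) (integrable A)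

  f-random-mean : ∀ (A : Realization → Subset size) →
    HasMean (λ Φ → f (A Φ) Φ) (mean (λ Φ → f (A Φ) Φ))
  f-random-mean A = HasMean-mean (λ Φ → f-mono Φ Subset.⊆⊤) (f-mean Subset.⊤)

  benefit : Maybe Edge → Subset size → Realization → Carrier
  benefit c A Φ = mean (gain c A Φ)

  benefit-mean : ∀ c A Φ → Fresh c A → HasMean (gain c A Φ) (benefit c A Φ)
  benefit-mean nothing  A Φ _ = HasMean-mean (λ _ → ≤-refl) (HasMean-const ≤-refl)
  benefit-mean (just e) A Φ fresh =
    HasMean-mean (λ Φ′ → marginal≤f⁅e⁆ Φ Φ′ (fresh ≡.refl)) (f-mean ⁅ e ⁆)

  benefit-nonNeg : ∀ c A Φ → Fresh c A → 0# ≤ benefit c A Φ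
  benefit-nonNeg c A Φ fresh = HasMean-≤ (λ Φ′ _ → gain-nonNeg c A Φ Φ′)
    (HasMean-const ≤-refl) (benefit-mean c A Φ fresh)

  benefit-nothing : ∀ A Φ → benefit nothing A Φ ≈ 0#
  benefit-nothing A Φ = HasSum-unique (benefit-mean nothing A Φ λ ()) (HasMean-const ≤-refl)

  benefit-antitone : ∀ {A B e} Φ → A Subset.⊆ B → e Subset.∉ B →
    benefit (just e) B Φ ≤ benefit (just e) A Φ
  benefit-antitone {A} {B} {e} Φ A⊆B e∉B = HasMean-≤
    (λ Φ′ _ → marginal-antitone Φ Φ (lookup Φ′ e) A⊆B e∉B (λ _ → ≡.refl))
    (benefit-mean (just e) B Φ λ { ≡.refl → e∉B })
    (benefit-mean (just e) A Φ λ { ≡.refl → e∉B ∘ A⊆B })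

  benefit-local : ∀ {A e} Φ Φ′ → e Subset.∉ A →
    (∀ {i} → i Subset.∈ A → lookup Φ i ≡ lookup Φ′ i) →
    benefit (just e) A Φ ≈ benefit (just e) A Φ′
  benefit-local {A} {e} Φ Φ′ e∉A agree = HasSum-unique
    (HasMean-cong (λ Φ″ → marginal-local Φ Φ′ (lookup Φ″ e) e∉A agree)
      (benefit-mean (just e) A Φ λ { ≡.refl → e∉A }))
    (benefit-mean (just e) A Φ′ λ { ≡.refl → e∉A })

  module _ (P : Process) where
    open Process P

    -- The compensator of the utility along the process: its increments average over the outcome of
    -- the pick, with the history held fixed.
    benefits : ℕ → Realization → Carrier
    benefits zero    Φ = 0#
    benefits (suc k) Φ = benefits k Φ + benefit (pick k Φ) (current k Φ) Φ

    benefits-nonNeg : ∀ k Φ → 0# ≤ benefits k Φ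
    benefits-nonNeg zero    Φ = ≤-refl
    benefits-nonNeg (suc k) Φ = +-nonNeg (benefits-nonNeg k Φ) (benefit-nonNeg _ _ Φ (fresh k Φ))

    pick-gain : ℕ → Realization → Realization → Carrier
    pick-gain k Φ Φ′ = gain (pick k Φ) (current k Φ) Φ Φ′

    gain-mean⇒benefit-mean : ∀ k {s} → HasMean (λ Φ → pick-gain k Φ Φ) s →
      HasMean (λ Φ → benefit (pick k Φ) (current k Φ) Φ) s
    gain-mean⇒benefit-mean k = resample (pick k)
      (λ o → proj₁ ∘ adapted k o)
      (λ Φ Φ′ → gain-nonNeg (pick k Φ) _ _ _)
      unpicked picked
      (λ Φ → benefit-mean _ _ Φ (fresh k Φ))
      where
      unpicked : ∀ {Φ} Φ′ → pick k Φ ≡ nothing → pick-gain k Φ Φ ≈ pick-gain k Φ Φ′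
      unpicked Φ′ eq rewrite eq = refl
      picked : ∀ {Φ e} Φ′ → pick k Φ ≡ just e →
        pick-gain k (Φ [ e ]≔ lookup Φ′ e) (Φ [ e ]≔ lookup Φ′ e) ≈ pick-gain k Φ Φ′
      picked {Φ} {e} Φ′ eq
        rewrite proj₁ (adapted k (lookup Φ′ e) eq) | proj₂ (adapted k (lookup Φ′ e) eq) | eq
              | lookup∘update e Φ (lookup Φ′ e)
        = marginal-local (Φ [ e ]≔ lookup Φ′ e) Φ (lookup Φ′ e) e∉A (update-agrees e∉A Φ (lookup Φ′ e))
        where
        e∉A : e Subset.∉ current k Φ
        e∉A = fresh k Φ eq

    -- The Doob decomposition in mean: the utility is its initial value plus realised increments,
    -- and each increment has the same mean as its benefit.
    telescope : ∀ k {s} → HasMean (λ Φ → f (current k Φ) Φ) s →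
      HasMean (λ Φ → f (current 0 Φ) Φ + benefits k Φ) s
    telescope zero    f-s = HasMean-cong (λ Φ → sym (+-identityʳ _)) f-s
    telescope (suc k) {s} f-s = HasSum-value value $ HasMean-cong (λ Φ → +-assoc _ _ _) $
      HasMean-+ (λ Φ → +-nonNeg (f-nonNeg _ Φ) (benefits-nonNeg k Φ))
                (λ Φ → benefit-nonNeg _ _ Φ (fresh k Φ))
                (telescope k (f-random-mean (current k)))
                (gain-mean⇒benefit-mean k gain-mean)
      where
      f-step : ∀ Φ → f (current (suc k) Φ) Φ ≈ f (current k Φ) Φ + pick-gain k Φ Φ
      f-step Φ = trans (reflexive (≡.cong (λ A → f A Φ) (advance k Φ)))
                       (gain-insert (pick k Φ) (current k Φ) Φ)
      gain-mean : HasMean (λ Φ → pick-gain k Φ Φ) (mean (λ Φ → pick-gain k Φ Φ))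
      gain-mean = HasMean-mean
        (λ Φ → ≤-respʳ (sym (f-step Φ)) (y≤x+y (f-nonNeg _ Φ))) f-s
      value : mean (λ Φ → f (current k Φ) Φ) + mean (λ Φ → pick-gain k Φ Φ) ≈ s
      value = HasSum-unique
        (HasMean-+ (λ Φ → f-nonNeg _ Φ) (λ Φ → gain-nonNeg (pick k Φ) _ _ _)
                   (f-random-mean (current k)) gain-mean)
        (HasMean-cong f-step f-s)

  module _ {Ψ e} (e∉Ψ : e Subset.∉ dom Ψ) where

    -- The indicator tests the history `Φ` alone. Since `e ∉ dom Ψ`, resampling `e` does not disturb
    -- it.
    consistent-gain : Realization → Realization → Carrier
    consistent-gain Φ Φ′ = ((λ Φ → marginal (dom Ψ) e Φ (lookup Φ′ e)) ·𝟙 (_∼ Ψ)) Φ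

    consistent-gain-mean : ∀ Φ →
      HasMean (consistent-gain Φ) ((benefit (just e) (dom Ψ) ·𝟙 (_∼ Ψ)) Φ)
    consistent-gain-mean Φ with em {Φ ∼ Ψ}
    ... | yes _ = benefit-mean (just e) (dom Ψ) Φ λ { ≡.refl → e∉Ψ }
    ... | no  _ = HasMean-const ≤-refl

    consistent-gain-update : ∀ Φ Φ′ →
      let Φ″ = Φ [ e ]≔ lookup Φ′ e in consistent-gain Φ″ Φ″ ≈ consistent-gain Φ Φ′
    consistent-gain-update Φ Φ′ with em {Φ ∼ Ψ}
    ... | yes Φ∼Ψ = trans (·𝟙-∈ _ (_∼ Ψ) (λ {i} → proj₂ (∼-update Ψ {Φ = Φ} e∉Ψ o) Φ∼Ψ {i}))
      (trans (reflexive (≡.cong (marginal (dom Ψ) e (Φ [ e ]≔ o)) (lookup∘update e Φ o)))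
             (marginal-local (Φ [ e ]≔ o) Φ o e∉Ψ (update-agrees e∉Ψ Φ o)))
      where
      o : O
      o = lookup Φ′ e
    ... | no Φ≁Ψ =
      ·𝟙-∉ _ (_∼ Ψ) (λ Φ″∼Ψ → Φ≁Ψ λ {i} → proj₁ (∼-update Ψ {Φ = Φ} e∉Ψ (lookup Φ′ e)) Φ″∼Ψ {i})

    -- By independence, conditioning on `Ψ` leaves the law of the unobserved outcome of `e`
    -- unchanged. This translates the greedy condition into benefits.
    Δ-benefit : ∀ {Φ} → Φ ∼ Ψ → 0# < Prob 𝒫 (_∼ Ψ) →
      Δ 𝒫 f e Ψ ≈ benefit (just e) (dom Ψ) Φ
    Δ-benefit {Φ} Φ∼Ψ (_ , 0≉Prob) = begin-equality
      𝔼-on 𝒫 Q X * Prob 𝒫 Q ⁻¹        ≈⟨ *-congʳ (𝔼-on-value 0≤X X-sum) ⟩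
      s * Prob 𝒫 Q ⁻¹                 ≈⟨ *-congʳ s≈δ*Prob ⟩
      (δ * Prob 𝒫 Q) * Prob 𝒫 Q ⁻¹    ≈⟨ *-assoc _ _ _ ⟩
      δ * (Prob 𝒫 Q * Prob 𝒫 Q ⁻¹)    ≈⟨ *-congˡ (⁻¹-inverse (0≉Prob ∘ sym)) ⟩
      δ * 1#                          ≈⟨ *-identityʳ δ ⟩
      δ                               ∎
      where
      open ≤-Reasoning
      Q : Pred Realization 0ℓ
      Q = _∼ Ψ
      X : Realization → Carrier
      X Φ = f (dom Ψ Subset.∪ ⁅ e ⁆) Φ - f (dom Ψ) Φ
      δ s : Carrier
      δ = benefit (just e) (dom Ψ) Φ
      s = mean (λ Φ → consistent-gain Φ Φ)
      0≤X : ∀ Φ → 0# ≤ X Φ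
      0≤X Φ = x≤y⇒0≤y-x (f-mono Φ (Subset.p⊆p∪q {p = dom Ψ} ⁅ e ⁆))
      X-marginal : ∀ Φ → marginal (dom Ψ) e Φ (lookup Φ e) ≈ X Φ
      X-marginal Φ = +-congʳ (sym (SetFunction.cong f̂ (graph-insert (dom Ψ) e Φ)))
      consistent-gain≤f : ∀ Φ → consistent-gain Φ Φ ≤ f ⁅ e ⁆ Φ
      consistent-gain≤f Φ with em {Φ ∼ Ψ}
      ... | yes _ = marginal≤f⁅e⁆ Φ Φ e∉Ψ
      ... | no  _ = f-nonNeg ⁅ e ⁆ Φ
      s-mean : HasMean (λ Φ → consistent-gain Φ Φ) s
      s-mean = HasMean-mean consistent-gain≤f (f-mean ⁅ e ⁆)
      X-sum : HasSum (weighted 𝒫 X ·𝟙 Q) s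
      X-sum = HasSum-cong on-Q s-mean
        where
        on-Q : ∀ Φ → weighted 𝒫 (λ Φ → consistent-gain Φ Φ) Φ ≈ (weighted 𝒫 X ·𝟙 Q) Φ
        on-Q Φ with em {Φ ∼ Ψ}
        ... | yes _ = *-congˡ (X-marginal Φ)
        ... | no  _ = zeroʳ _
      -- Resampling `e` turns the marginal into its benefit. On the event this is the constant `δ`,
      -- because consistent realizations agree on `dom Ψ`.
      s≈δ*Prob : s ≈ δ * Prob 𝒫 Q
      s≈δ*Prob = HasSum-unique
        (resample (λ _ → just e) (λ _ eq → eq)
          (λ Φ Φ′ → ·𝟙-nonNeg Q (λ Φ → marginal-nonNeg (dom Ψ) e Φ _) Φ)
          (λ _ ()) (λ { {Φ} Φ′ ≡.refl → consistent-gain-update Φ Φ′ })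
          consistent-gain-mean s-mean)
        (HasSum-cong on-Q (HasSum-* (benefit-nonNeg (just e) (dom Ψ) Φ λ { ≡.refl → e∉Ψ }) (Prob-sum Q)))
        where
        on-Q : ∀ Φ′ → δ * (mass 𝒫 ·𝟙 Q) Φ′ ≈ weighted 𝒫 (benefit (just e) (dom Ψ) ·𝟙 Q) Φ′
        on-Q Φ′ with em {Φ′ ∼ Ψ}
        ... | yes Φ′∼Ψ = trans (*-comm _ _) (*-congˡ (benefit-local Φ Φ′ e∉Ψ (∼-agree Ψ {Φ} {Φ′} Φ∼Ψ Φ′∼Ψ)))
        ... | no  _    = trans (zeroʳ _) (sym (zeroʳ _))

-- Charging and the approximation ratio

module Guarantee
  (em : ExcludedMiddle 0ℓ) (ℝ : RealNumbers) (G : Graph) (d : Graph.Vertex G → ℕ) (O : Set)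
  (𝒫 : Matchmaking.Distribution ℝ G d O) (independent : Matchmaking.Independent ℝ G d O 𝒫)
  (f̂ : SetFunctions.SetFunction ℝ (Graph.Edge G × O))
  (monotone : SetFunctions.Monotone ℝ f̂) (submodular : SetFunctions.Submodular ℝ f̂)
  (integrable : ∀ A →
    Matchmaking.HasExpectation ℝ G d O 𝒫 (Matchmaking.utility ℝ G d O f̂ A)) where
  open Matchmaking ℝ G d O
  open RealNumbers ℝ hiding (zero)
  open RealProperties ℝ
  open Graph G
  open Summation em ℝ
  open Expectation em ℝ Realization 𝒫
  open Policies ℝ G d O
  open SubmodularUtility ℝ G d O f̂ monotone submodular
  open Benefits em ℝ G d O 𝒫 independent f̂ monotone submodular integrable
  open SubsetProperties
  open Degrees G
  open Weight ℝ
  open Process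

  𝓘-⊆ : ∀ {A B} → A Subset.⊆ B → B ∈ 𝓘 → A ∈ 𝓘
  𝓘-⊆ A⊆B B∈𝓘 v = ℕ.≤-trans (deg-mono v A⊆B) (B∈𝓘 v)

  value : Edge → Subset size → Realization → Carrier
  value e = benefit (just e)

  0≤value : ∀ {e A} Φ → e Subset.∉ A → 0# ≤ value e A Φ
  0≤value {e} {A} Φ e∉A = benefit-nonNeg (just e) A Φ λ { ≡.refl → e∉A }

  benefits-nothing : ∀ P k Φ → pick P k Φ ≡ nothing → benefits P (suc k) Φ ≈ benefits P k Φ
  benefits-nothing P k Φ eq rewrite eq =
    trans (+-congˡ (benefit-nothing (current P k Φ) Φ)) (+-identityʳ _)

  benefits-just : ∀ P k Φ {e} → pick P k Φ ≡ just e →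
    benefits P (suc k) Φ ≈ benefits P k Φ + value e (current P k Φ) Φ
  benefits-just P k Φ eq rewrite eq = refl

  benefits-mono : ∀ P k Φ → benefits P k Φ ≤ benefits P (suc k) Φ
  benefits-mono P k Φ = x≤x+y (benefit-nonNeg _ _ Φ (fresh P k Φ))

  module _ {α : Carrier} (0≤α : 0# ≤ α) {π : Policy} (greedy : ApproxGreedy 𝒫 f α π)
           {π* : Policy} (feasible : FeasiblePolicy π*) where

    -- `𝒪` starts from the final selection of `π`, so its benefits measure what `π*` adds. That
    -- start is admissible because it does not react to outcomes of items outside it.
    𝒢 𝒪 : Process
    𝒢 = follow (λ _ → Subset.⊥) (λ _ _ _ → ≡.refl) π
    𝒪 = follow (selected π) (λ Φ o e∉ → ≡.cong dom (run-update π Φ size o e∉)) π*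

    module _ {Φ : Realization} (μ≉0 : ¬ mass 𝒫 Φ ≈ 0#) where

      S S* : ℕ → Subset size
      S  k = dom (run π Φ k)
      S* k = dom (run π* Φ k)

      𝒢-current : ∀ k → current 𝒢 k Φ ≡ S k
      𝒢-current k = Subset.∪-identityˡ (S k)

      -- Makes the greedy condition available at every step along `Φ`.
      Prob-run-pos : ∀ k → 0# < Prob 𝒫 (_∼ run π Φ k)
      Prob-run-pos k = Prob-pos (λ {e} {o} → run-consistent π Φ k {e} {o}) μ≉0

      candidate-step : ∀ k → Satisfiable (Candidate (run π Φ k)) →
        ∃[ e ] chosen π Φ k ≡ just e × Candidate (run π Φ k) e ×
          (∀ {i} → Candidate (run π Φ k) i → α * value i (S k) Φ ≤ value e (S k) Φ)
      candidate-step k candidate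
        with proj₁ (greedy (run π Φ k) (Φ , k , ≡.refl) (Prob-run-pos k)) candidate
      ... | e , chosen≡e , candidate-e@(e∉S , _) , best = e , chosen≡e , candidate-e , bound
        where
        Ψ : PartialRealization
        Ψ = run π Φ k
        Δ≈value : ∀ {i} → i Subset.∉ S k → Δ 𝒫 f i Ψ ≈ value i (S k) Φ
        Δ≈value i∉S = Δ-benefit i∉S {Φ}
          (λ {e} {o} → run-consistent π Φ k {e} {o})
          (Prob-run-pos k)
        bound : ∀ {i} → Candidate Ψ i → α * value i (S k) Φ ≤ value e (S k) Φ
        bound {i} (i∉S , i-feasible) = begin
          α * value i (S k) Φ           ≈⟨ *-congˡ (Δ≈value i∉S) ⟨
          α * Δ 𝒫 f i Ψ                 ≤⟨ *-monoʳ-≤ 0≤α (All.lookup (Extrema.xs≤max totalOrder _ _) Δ∈Δs) ⟩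
          α * max (Δ 𝒫 f e Ψ) Δs        ≤⟨ best ⟩
          Δ 𝒫 f e Ψ                     ≈⟨ Δ≈value e∉S ⟩
          value e (S k) Φ               ∎
          where
          open ≤-Reasoning
          Δs : List Carrier
          Δs = mapᴸ (λ e′ → Δ 𝒫 f e′ Ψ) (feasibleEdges Ψ)
          Δ∈Δs : Δ 𝒫 f i Ψ ∈ᴸ Δs
          Δ∈Δs = ∈-map⁺ (λ e′ → Δ 𝒫 f e′ Ψ)
            (∈-filter⁺ (λ e′ → 𝓘? (dom Ψ Subset.∪ ⁅ e′ ⁆)) (∈-allFin i) i-feasible)

      no-candidate-step : ∀ k → ¬ Satisfiable (Candidate (run π Φ k)) → chosen π Φ k ≡ nothing
      no-candidate-step k = proj₂ (greedy (run π Φ k) (Φ , k , ≡.refl) (Prob-run-pos k))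

      candidate-earlier : ∀ {j k e} → j ℕ.≤ k → Candidate (run π Φ k) e → Candidate (run π Φ j) e
      candidate-earlier {j} {k} {e} j≤k (e∉ , e-feasible) =
        e∉ ∘ dom-run-≤ π Φ j≤k , 𝓘-⊆ (∪-mono {q = S k} {q′ = ⁅ e ⁆} (dom-run-≤ π Φ j≤k) id) e-feasible

      -- A candidate at step `k` was one at every earlier step, so `π` never stopped before and each
      -- step added a new edge.
      candidate⇒k≤∣S∣ : ∀ {k e} → Candidate (run π Φ k) e → k ℕ.≤ ∣ S k ∣
      candidate⇒k≤∣S∣ {zero}  candidate = ℕ.z≤n
      candidate⇒k≤∣S∣ {suc k} candidate
        with candidate-step k (_ , candidate-earlier (ℕ.n≤1+n k) candidate)
      ... | e , chosen≡e , (e∉S , _) , _ = begin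
        suc k         ≤⟨ s≤s (candidate⇒k≤∣S∣ (candidate-earlier (ℕ.n≤1+n k) candidate)) ⟩
        suc ∣ S k ∣   ≤⟨ Subset.p⊂q⇒∣p∣<∣q∣ (dom-run-mono π Φ k , e , e∈S′ , e∉S) ⟩
        ∣ S (suc k) ∣ ∎
        where
        open ℕ.≤-Reasoning
        e∈S′ : e Subset.∈ S (suc k)
        e∈S′ = ≡.subst (e Subset.∈_) (≡.sym (dom-run-select π Φ k chosen≡e))
          (Subset.q⊆p∪q (S k) ⁅ e ⁆ (Subset.x∈⁅x⁆ e))

      -- Cutting the run off after `size` steps does not cut the greedy choice short: a surviving
      -- candidate would mean that all edges, itself included, are selected.
      no-final-candidate : ¬ Satisfiable (Candidate (run π Φ size))
      no-final-candidate (e , candidate@(e∉S , _)) = e∉S (≡.subst (e Subset.∈_) (≡.sym S≡⊤) Subset.∈⊤)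
        where
        S≡⊤ : S size ≡ Subset.⊤
        S≡⊤ = Subset.∣p∣≡n⇒p≡⊤ (ℕ.≤-antisym (Subset.∣p∣≤n (S size)) (candidate⇒k≤∣S∣ candidate))

      -- An upper bound on what an edge of `π*` can add, scaled by `α`. It is zero on edges selected
      -- by `π`: they are never picks of `𝒪`, and `value` would pair them with a second, conflicting
      -- outcome.
      w : Edge → Carrier
      w e with e Subset.∈? S size
      ... | yes _ = 0#
      ... | no  _ = α * value e (S size) Φ

      0≤w : ∀ e → 0# ≤ w e
      0≤w e with e Subset.∈? S size
      ... | yes _  = ≤-refl
      ... | no e∉S = *-nonNeg 0≤α (0≤value Φ e∉S)

      w-∈ : ∀ {e} → e Subset.∈ S size → w e ≈ 0#
      w-∈ {e} e∈S with e Subset.∈? S size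
      ... | yes _  = refl
      ... | no e∉S = contradiction e∈S e∉S

      w-∉ : ∀ {e} → e Subset.∉ S size → w e ≈ α * value e (S size) Φ
      w-∉ {e} e∉S with e Subset.∈? S size
      ... | yes e∈S = contradiction e∈S e∉S
      ... | no _    = refl

      -- S k ∪ T stays feasible while T loses at most two edges per greedy
      -- step, and each lost edge was a candidate at the step that lost it.
      charging : ∀ k → k ℕ.≤ size → ∃[ T ] S k Subset.∪ T ∈ 𝓘 ×
        weight w (S* size) ≤ weight w T + (benefits 𝒢 k Φ + benefits 𝒢 k Φ)
      charging zero    _   = S* size
        , 𝓘-⊆ (∪-⊆ (λ e∈ → contradiction e∈ dom-∅) id) (feasible Φ)
        , x≤x+y (+-nonNeg ≤-refl ≤-refl)
      charging (suc k) k<n with charging k (ℕ.<⇒≤ k<n) | em {Satisfiable (Candidate (run π Φ k))}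
      ... | T , S∪T∈𝓘 , bound | no none = T
        , ≡.subst (λ Ψ → dom Ψ Subset.∪ T ∈ 𝓘) (≡.sym (run-stop π Φ k (no-candidate-step k none))) S∪T∈𝓘
        , ≤-trans bound (+-monoʳ-≤ _ (+-mono-≤ (benefits-mono 𝒢 k Φ) (benefits-mono 𝒢 k Φ)))
      ... | T , S∪T∈𝓘 , bound | yes candidate with candidate-step k candidate
      ...   | e , chosen≡e , (e∉S , S+e∈𝓘) , best with exchange {S k} {T} {e} e∉S S+e∈𝓘 S∪T∈𝓘
      ...     | t₁ , t₂ , exchanged = T₂
        , ≡.subst (λ A → A Subset.∪ T₂ ∈ 𝓘) (≡.sym (dom-run-select π Φ k chosen≡e)) exchanged
        , (begin
          weight w (S* size)                        ≤⟨ bound ⟩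
          weight w T + (b + b)                      ≤⟨ +-monoˡ-≤ _ (weight-remove 0≤w 0≤g {T} t₁ w≤g) ⟩
          (weight w T₁ + g) + (b + b)
            ≤⟨ +-monoˡ-≤ _ (+-monoˡ-≤ g (weight-remove 0≤w 0≤g {T₁} t₂ (w≤g ∘ proj₁ ∘ ∈-remove⁻ {p = T}))) ⟩
          ((weight w T₂ + g) + g) + (b + b)         ≈⟨ +-congʳ (+-assoc _ _ _) ⟩
          (weight w T₂ + (g + g)) + (b + b)         ≈⟨ +-assoc _ _ _ ⟩
          weight w T₂ + ((g + g) + (b + b))         ≈⟨ +-congˡ (+.interchange _ _ _ _) ⟩
          weight w T₂ + ((g + b) + (g + b))         ≈⟨ +-congˡ (+-cong g+b g+b) ⟩
          weight w T₂ + (b′ + b′)                   ∎)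
        where
        open ≤-Reasoning
        T₁ T₂ : Subset size
        T₁ = remove t₁ T
        T₂ = remove t₂ T₁
        g b b′ : Carrier
        g = value e (S k) Φ
        b = benefits 𝒢 k Φ
        b′ = benefits 𝒢 (suc k) Φ
        0≤g : 0# ≤ g
        0≤g = 0≤value Φ e∉S
        pick≡e : pick 𝒢 k Φ ≡ just e
        pick≡e = ≡.trans (≡.cong (newly _) chosen≡e)
          (newly-∉ (e∉S ∘ ≡.subst (e Subset.∈_) (𝒢-current k)))
        g+b : g + b ≈ b′
        g+b = trans (+-comm g b) (sym (trans (benefits-just 𝒢 k Φ pick≡e)
          (+-congˡ (reflexive (≡.cong (λ A → value e A Φ) (𝒢-current k))))))
        -- An edge of `T` that `π` never selects is a candidate now, since `S k ∪ T` is feasible.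
        -- Its value only falls between `S k` and `S size`, so the greedy bound at step `k` covers
        -- it.
        w≤g : ∀ {t} → t Subset.∈ T → w t ≤ g
        w≤g {t} t∈T with t Subset.∈? S size
        ... | yes _  = 0≤g
        ... | no t∉S = ≤-trans
          (*-monoʳ-≤ 0≤α (benefit-antitone Φ S⊆ t∉S))
          (best (t∉S ∘ S⊆ , 𝓘-⊆ (∪-mono {q = S k} {q′ = T} id (⁅⁆-⊆ t∈T)) S∪T∈𝓘))
          where
          S⊆ : S k Subset.⊆ S size
          S⊆ = dom-run-≤ π Φ (ℕ.<⇒≤ k<n)

      -- Nothing stays uncharged: an edge of the last `T` outside `S size` would be a final
      -- candidate, so all of `T` has weight zero.
      weight≤benefits𝒢 : weight w (S* size) ≤ benefits 𝒢 size Φ + benefits 𝒢 size Φ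
      weight≤benefits𝒢 with charging size ℕ.≤-refl
      ... | T , S∪T∈𝓘 , bound = ≤-respʳ
        (trans (+-congʳ (weight-zero T w≈0)) (+-identityˡ _)) bound
        where
        w≈0 : ∀ {e} → e Subset.∈ T → w e ≈ 0#
        w≈0 {e} e∈T with em {e Subset.∈ S size}
        ... | yes e∈S = w-∈ e∈S
        ... | no e∉S  = contradiction
          (e , e∉S , 𝓘-⊆ (∪-mono {q = S size} {q′ = T} id (⁅⁆-⊆ e∈T)) S∪T∈𝓘) no-final-candidate

      -- Each pick of `𝒪` is a new edge outside `S size`, and dropping the earlier selections of
      -- `π*` from its context can only raise its benefit.
      benefits𝒪≤weight : ∀ k → α * benefits 𝒪 k Φ ≤ weight w (S* k)
      benefits𝒪≤weight zero    = ≤-reflexive (trans (zeroʳ α)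
        (sym (weight-zero (S* 0) λ e∈ → contradiction e∈ dom-∅)))
      benefits𝒪≤weight (suc k) = by-pick (pick 𝒪 k Φ) ≡.refl
        where
        open ≤-Reasoning
        by-pick : ∀ c → pick 𝒪 k Φ ≡ c → α * benefits 𝒪 (suc k) Φ ≤ weight w (S* (suc k))
        by-pick nothing eq = begin
          α * benefits 𝒪 (suc k) Φ   ≈⟨ *-congˡ (benefits-nothing 𝒪 k Φ eq) ⟩
          α * benefits 𝒪 k Φ            ≤⟨ benefits𝒪≤weight k ⟩
          weight w (S* k)            ≤⟨ weight-mono 0≤w (dom-run-mono π* Φ k) ⟩
          weight w (S* (suc k))      ∎
        by-pick (just e) eq = begin
          α * benefits 𝒪 (suc k) Φ                            ≈⟨ *-congˡ (benefits-just 𝒪 k Φ eq) ⟩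
          α * (benefits 𝒪 k Φ + value e (current 𝒪 k Φ) Φ)    ≈⟨ distribˡ α _ _ ⟩
          α * benefits 𝒪 k Φ + α * value e (current 𝒪 k Φ) Φ
            ≤⟨ +-mono-≤ (benefits𝒪≤weight k) (*-monoʳ-≤ 0≤α (benefit-antitone Φ (Subset.p⊆p∪q (S* k)) e∉)) ⟩
          weight w (S* k) + α * value e (S size) Φ
            ≈⟨ +-congˡ (w-∉ (e∉ ∘ Subset.p⊆p∪q (S* k))) ⟨
          weight w (S* k) + w e
            ≈⟨ weight-insert w (S* k) (e∉ ∘ Subset.q⊆p∪q (S size) (S* k)) ⟨
          weight w (S* k Subset.∪ ⁅ e ⁆)
            ≡⟨ ≡.cong (weight w) (dom-run-select π* Φ k (proj₁ new)) ⟨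
          weight w (S* (suc k))                               ∎
          where
          new : chosen π* Φ k ≡ just e × e Subset.∉ current 𝒪 k Φ
          new = newly-just (current 𝒪 k Φ) (chosen π* Φ k) eq
          e∉ : e Subset.∉ current 𝒪 k Φ
          e∉ = proj₂ new

      benefits𝒪≤benefits𝒢+benefits𝒢 : α * benefits 𝒪 size Φ ≤ benefits 𝒢 size Φ + benefits 𝒢 size Φ
      benefits𝒪≤benefits𝒢+benefits𝒢 = ≤-trans (benefits𝒪≤weight size) weight≤benefits𝒢

    α*avg*≤[2+α]*avg : α * avg 𝒫 f π* ≤ (2# + α) * avg 𝒫 f π
    α*avg*≤[2+α]*avg = begin
      α * avg 𝒫 f π*         ≈⟨ *-congˡ (𝔼-value (λ Φ → f-nonNeg _ Φ) (f-random-mean (selected π*))) ⟩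
      α * mean (f-at (selected π*))    ≤⟨ *-monoʳ-≤ 0≤α (HasMean-≤
        (λ Φ _ → f-mono Φ (Subset.q⊆p∪q (selected π Φ) (selected π* Φ)))
        (f-random-mean (selected π*)) (f-random-mean (current 𝒪 size))) ⟩
      α * mean (f-at (current 𝒪 size)) ≈⟨ *-congˡ (HasSum-unique
        (telescope 𝒪 size (f-random-mean (current 𝒪 size)))
        (HasMean-+ (λ Φ → f-nonNeg _ Φ) (benefits-nonNeg 𝒪 size) (f-random-mean (current 𝒪 0)) benefits𝒪-mean)) ⟩
      α * (mean (f-at (current 𝒪 0)) + mean (benefits 𝒪 size))    ≈⟨ distribˡ α _ _ ⟩
      α * mean (f-at (current 𝒪 0)) + α * mean (benefits 𝒪 size)
        ≤⟨ +-mono-≤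
          (*-monoʳ-≤ 0≤α (HasMean-≤
            -- `current 𝒪 0` is the selection of `π` joined with the empty start of `π*`.
            (λ Φ _ → f-mono Φ (∪-⊆ id (λ e∈ → contradiction e∈ dom-∅)))
            (f-random-mean (current 𝒪 0)) (f-random-mean (selected π))))
          (HasMean-≤ (λ Φ → benefits𝒪≤benefits𝒢+benefits𝒢) (HasMean-* 0≤α benefits𝒪-mean)
            (HasMean-+ (benefits-nonNeg 𝒢 size) (benefits-nonNeg 𝒢 size) benefits𝒢-mean benefits𝒢-mean)) ⟩
      α * p + (mean (benefits 𝒢 size) + mean (benefits 𝒢 size))
        ≤⟨ +-monoʳ-≤ (α * p) (+-mono-≤ benefits𝒢≤p benefits𝒢≤p) ⟩
      α * p + (p + p)                  ≈⟨ +-comm _ _ ⟩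
      (p + p) + α * p                  ≈⟨ +-congʳ (+-cong (*-identityˡ p) (*-identityˡ p)) ⟨
      (1# * p + 1# * p) + α * p        ≈⟨ +-congʳ (distribʳ p 1# 1#) ⟨
      2# * p + α * p                   ≈⟨ distribʳ p 2# α ⟨
      (2# + α) * p                     ≈⟨ *-congˡ (𝔼-value (λ Φ → f-nonNeg _ Φ) (f-random-mean (selected π))) ⟨
      (2# + α) * avg 𝒫 f π   ∎
      where
      open ≤-Reasoning
      f-at : (Realization → Subset size) → Realization → Carrier
      f-at A Φ = f (A Φ) Φ
      p : Carrier
      p = mean (f-at (selected π))
      benefits𝒪-mean : HasMean (benefits 𝒪 size) (mean (benefits 𝒪 size))
      benefits𝒪-mean = HasMean-mean (λ Φ → y≤x+y (f-nonNeg (current 𝒪 0 Φ) Φ))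
        (telescope 𝒪 size (f-random-mean (current 𝒪 size)))
      𝒢-telescope : HasMean (λ Φ → f-at (current 𝒢 0) Φ + benefits 𝒢 size Φ) p
      𝒢-telescope = telescope 𝒢 size
        (HasMean-cong (λ Φ → reflexive (≡.cong (λ A → f A Φ) (≡.sym (Subset.∪-identityˡ (selected π Φ)))))
          (f-random-mean (selected π)))
      benefits𝒢-mean : HasMean (benefits 𝒢 size) (mean (benefits 𝒢 size))
      benefits𝒢-mean = HasMean-mean (λ Φ → y≤x+y (f-nonNeg (current 𝒢 0 Φ) Φ)) 𝒢-telescope
      -- The two sides differ by the mean utility of the empty selection, which is nonnegative.
      benefits𝒢≤p : mean (benefits 𝒢 size) ≤ p
      benefits𝒢≤p = HasMean-≤ (λ Φ _ → y≤x+y (f-nonNeg (current 𝒢 0 Φ) Φ)) benefits𝒢-mean 𝒢-telescope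

    approximation : avg 𝒫 f π ≥ α / (2# + α) * avg 𝒫 f π*
    approximation = begin
      α * (2# + α) ⁻¹ * avg 𝒫 f π*       ≈⟨ *.xy∙z≈y∙xz _ _ _ ⟩
      (2# + α) ⁻¹ * (α * avg 𝒫 f π*)     ≤⟨ *-monoʳ-≤ (⁻¹-nonNeg 0≤2+α 2+α≉0) α*avg*≤[2+α]*avg ⟩
      (2# + α) ⁻¹ * ((2# + α) * avg 𝒫 f π) ≈⟨ x⁻¹*[x*y]≈y 2+α≉0 _ ⟩
      avg 𝒫 f π                          ∎
      where
      open ≤-Reasoning
      1≤2+α : 1# ≤ 2# + α
      1≤2+α = ≤-trans (x≤x+y 0≤1) (x≤x+y 0≤α)
      0≤2+α : 0# ≤ 2# + α
      0≤2+α = ≤-trans 0≤1 1≤2+α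
      2+α≉0 : ¬ 2# + α ≈ 0#
      2+α≉0 2+α≈0 = 0≉1 (≤-antisym 0≤1 (≤-respʳ 2+α≈0 1≤2+α))

theorem8 :
  ExcludedMiddle 0ℓ →
  (ℝ : RealNumbers) (G : Graph) (d : Graph.Vertex G → ℕ) (O : Set) →
  let open RealNumbers ℝ
      open Graph G
      open Matchmaking ℝ G d O
  in
  (𝒫 : Distribution) → Independent 𝒫 →
  (f̂ : SetFunction (Edge × O)) → Monotone f̂ → Submodular f̂ →
  let f = utility f̂ in
  (∀ A → HasExpectation 𝒫 (f A)) →
  (∀ α → 0# ≤ α → α ≤ 1# →
   ∀ π → ApproxGreedy 𝒫 f α π →
   ∀ π* → FeasiblePolicy π* →
   avg 𝒫 f π ≥ α / (2# + α) * avg 𝒫 f π*)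
  ×
  (∀ π → Greedy 𝒫 f π →
   ∀ π* → FeasiblePolicy π* →
   avg 𝒫 f π ≥ 1# / 3# * avg 𝒫 f π*)
theorem8 em ℝ G d O 𝒫 independent f̂ monotone submodular integrable =
  (λ α 0≤α _ π greedy π* feasible → approximation 0≤α greedy feasible) ,
  -- `3#` is by definition `2# + 1#`, so this is the general bound at `α = 1#`.
  (λ π greedy π* feasible → approximation 0≤1 greedy feasible)
  where
  open RealProperties ℝ using (0≤1)
  open Guarantee em ℝ G d O 𝒫 independent f̂ monotone submodular integrable using (approximation)
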